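{- Let $G$ be a finite non-empty graph and let $k$ be a non-negative integer. Then $G$ has ab-tree-cut width $\leq k$ if and only if $G$ is $k$-searchable.
   Context: Graphs are finite and undirected; parallel edges are allowed, loops are not. A near-partition of a set $\Omega$ is a family of pairwise disjoint (possibly empty) subsets of $\Omega$ with union $\Omega$. Two vertices $u,v$ of $G$ are 3-edge-connected in $G$ if $u=v$ or there are three pairwise edge-disjoint paths in $G$ connecting $u$ and $v$. ab-tree-cut width. A tree-cut decomposition of $G$ is a pair $\mathcal{T}=(T,\mathcal{X})$ where $T$ is a tree and $\mathcal{X}=\{X_t : t\in V(T)\}$ is a near-partition of $V(G)$ indexed by the nodes of $T$; $X_t$ is the bag of $t$. For an edge $st$ of $T$, $\mathrm{adh}(st)$ is the set of edges $uv$ of $G$ such that the node whose bag contains $u$ and the node whose bag contains $v$ lie in different components of $T-st$. The edge $st$ is bold if $|\mathrm{adh}(st)|\geq 3$ and thin otherwise. For a node $t$, $\mathrm{adh}(t)$ is the union of the sets $\mathrm{adh}(st)$ over all bold edges $st$ of $T$ incident to $t$. The adhesion-width of $\mathcal{T}$ is $\max_{t\in V(T)}|\mathrm{adh}(t)|$ and the bag-width of $\mathcal{T}$ is $\max_{t\in V(T)}|X_t|$. The ab-tree-cut width of $G$ is the least number $k$ such that $G$ has a tree-cut decomposition with adhesion-width $\leq k$ and bag-width $\leq k$. The cops, dogs, and robber game with $p$ cops and $q$ dogs ($p,q\geq 0$ integers) is played on $G$ by two players, the cop player (controlling cops and dogs) and the robber player. The robber player first places the robber at a vertex $r_0$; the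 cops initially occupy the edge set $F_0=\emptyset$. In each round $i=1,2,3,\ldots$: the cop player announces a set $F_i\subseteq E(G)$ with $|F_i|\leq p$; then the robber player, knowing $F_i$, moves the robber from $r_{i-1}$ to a vertex $r_i$ (possibly $r_i=r_{i-1}$) that is reachable from $r_{i-1}$ by a path of $G$ containing no edge of $F_{i-1}\cap F_i$ and that is 3-edge-connected with $r_{i-1}$ in $G$; then the cops move to $F_i$. After each round $i$, if the number of vertices of $G$ that are 3-edge-connected with $r_i$ in $G$ and reachable from $r_i$ by a path avoiding the edges of $F_i$ (including $r_i$ itself) is $\leq q$, the cop player wins immediately. The robber player wins if she avoids being caught indefinitely. $G$ is searchable by $p$ cops and $q$ dogs if the cop player has a strategy to win this game, and $k$-searchable if it is searchable by $k$ cops and $k$ dogs. -}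

module Defs where

open import Data.Fin using (Fin)
open import Data.Fin.Subset
  using (Subset; ∣_∣; _∈_; _∉_; _∩_; ⁅_⁆; Empty) renaming (⊥ to ∅)
open import Data.List using (List; []; _∷_)
open import Data.List.Membership.Propositional using () renaming (_∉_ to _∉ˡ_)
open import Data.List.Relation.Binary.Disjoint.Propositional using (Disjoint)
open import Data.List.Relation.Unary.All using (All)
open import Data.List.Relation.Unary.Unique.Propositional using (Unique)
open import Data.Nat using (ℕ; zero; suc; _≤_; _<_)
open import Data.Product using (Σ-syntax; ∃-syntax; _×_; _,_; proj₁; proj₂)
open import Data.Sum using (_⊎_)
open import Data.Vec using (Vec; []; _∷_)
open import Level using (0ℓ)
open import Relation.Binary.PropositionalEquality using (_≡_; _≢_)
open import Relation.Nullary using (¬_)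
open import Relation.Unary using (Pred; _≐_)

-- Cardinality of { x | P x }: the set is first realised, exactly, as a Subset.

∣_∣≤_ : ∀ {n} → Pred (Fin n) 0ℓ → ℕ → Set
∣ P ∣≤ k = ∃[ S ] ((_∈ S) ≐ P) × ∣ S ∣ ≤ k

_≤∣_∣ : ∀ {n} → ℕ → Pred (Fin n) 0ℓ → Set
k ≤∣ P ∣ = ∃[ S ] ((_∈ S) ≐ P) × k ≤ ∣ S ∣

-- The order in which ends lists the two endpoints of an edge is immaterial:
-- see Joins.  Distinct edges may have the same endpoints.

record Graph : Set where
  field
    order size : ℕ
    ends       : Fin size → Fin order × Fin order
    loopless   : ∀ e → proj₁ (ends e) ≢ proj₂ (ends e)

  Vertex Edge : Set
  Vertex = Fin order
  Edge   = Fin size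

  Joins : Edge → Vertex → Vertex → Set
  Joins e u v = ends e ≡ (u , v) ⊎ ends e ≡ (v , u)

  Incident : Edge → Vertex → Set
  Incident e v = ∃[ u ] Joins e v u

  data Walk : Vertex → Vertex → Set where
    stop : ∀ {u} → Walk u u
    step : ∀ {u v w} (e : Edge) → Joins e u v → Walk v w → Walk u w

  walkEdges : ∀ {u v} → Walk u v → List Edge
  walkEdges stop         = []
  walkEdges (step e _ w) = e ∷ walkEdges w

  walkVertices : ∀ {u v} → Walk u v → List Vertex
  walkVertices (stop {u})         = u ∷ []
  walkVertices (step {u} _ _ w) = u ∷ walkVertices w

  Path : Vertex → Vertex → Set
  Path u v = Σ[ w ∈ Walk u v ] Unique (walkVertices w)

  edges : ∀ {u v} → Path u v → List Edge
  edges (w , _) = walkEdges w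

  ReachableAvoiding : Subset size → Vertex → Vertex → Set
  ReachableAvoiding F u v = Σ[ p ∈ Path u v ] All (_∉ F) (edges p)

  ThreeEdgeConnected : Vertex → Vertex → Set
  ThreeEdgeConnected u v =
    u ≡ v ⊎
    Σ[ p ∈ Path u v ] Σ[ q ∈ Path u v ] Σ[ r ∈ Path u v ]
      Disjoint (edges p) (edges q) ×
      Disjoint (edges p) (edges r) ×
      Disjoint (edges q) (edges r)

  -- A cycle is a path together with a further edge joining its two ends;
  -- two parallel edges form a cycle.
  Cycle : Set
  Cycle = ∃[ u ] ∃[ v ] Σ[ p ∈ Path u v ] ∃[ e ] Joins e u v × e ∉ˡ edges p

  record IsTree : Set where
    field
      nonEmpty  : 0 < order
      connected : ∀ u v → Path u v
      acyclic   : ¬ Cycle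

open Graph using (order; size; Vertex; Edge)

record TreeCutDecomposition (G : Graph) : Set where
  field
    tree   : Graph
    isTree : Graph.IsTree tree

  private
    module G = Graph G
    module T = Graph tree

  field
    bag      : T.Vertex → Subset G.order
    disjoint : ∀ {s t} → s ≢ t → Empty (bag s ∩ bag t)
    cover    : ∀ v → ∃[ t ] v ∈ bag t

  -- Unique by disjoint.
  node : G.Vertex → T.Vertex
  node v = proj₁ (cover v)

  -- Lying in different components of T - st means not being joined by a path
  -- of T that avoids st.
  edgeAdh : T.Edge → Pred G.Edge 0ℓ
  edgeAdh st e = ¬ T.ReachableAvoiding ⁅ st ⁆ (node u) (node v)
    where
    u = proj₁ (G.ends e)
    v = proj₂ (G.ends e)

  Bold : T.Edge → Set
  Bold st = 3 ≤∣ edgeAdh st ∣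

  nodeAdh : T.Vertex → Pred G.Edge 0ℓ
  nodeAdh t e = ∃[ st ] T.Incident st t × Bold st × edgeAdh st e

  AdhesionWidth≤ : ℕ → Set
  AdhesionWidth≤ k = ∀ t → ∣ nodeAdh t ∣≤ k

  BagWidth≤ : ℕ → Set
  BagWidth≤ k = ∀ t → ∣ bag t ∣ ≤ k

HasDecompositionOfWidth≤ : Graph → ℕ → Set
HasDecompositionOfWidth≤ G k =
  Σ[ D ∈ TreeCutDecomposition G ]
    TreeCutDecomposition.AdhesionWidth≤ D k × TreeCutDecomposition.BagWidth≤ D k

IsABTreeCutWidth : Graph → ℕ → Set
IsABTreeCutWidth G w =
  HasDecompositionOfWidth≤ G w × (∀ j → HasDecompositionOfWidth≤ G j → w ≤ j)

ABTreeCutWidth≤ : Graph → ℕ → Set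
ABTreeCutWidth≤ G k = ∃[ w ] IsABTreeCutWidth G w × w ≤ k

module Game (G : Graph) where
  open Graph G hiding (order; size; Vertex; Edge)

  -- announce is given the robber's positions r_{i-1}, …, r_0, latest first, and
  -- returns F_i.  The earlier sets F_j need not be recorded, being determined by
  -- the strategy and the robber's positions.
  record Strategy (p : ℕ) : Set where
    field
      announce : ∀ {i} → Vec (Vertex G) (suc i) → Subset (size G)
      bounded  : ∀ {i} (h : Vec (Vertex G) (suc i)) → ∣ announce h ∣ ≤ p

  history : (ℕ → Vertex G) → ∀ i → Vec (Vertex G) (suc i)
  history r zero    = r zero ∷ []
  history r (suc i) = r (suc i) ∷ history r i

  cops : ∀ {p} → Strategy p → (ℕ → Vertex G) → ℕ → Subset (size G)
  cops σ r zero    = ∅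
  cops σ r (suc i) = Strategy.announce σ (history r i)

  -- Staying put is always a legal move, so a play that has already been won by
  -- the cops can still be prolonged to an infinite one.
  LegalPlay : ∀ {p} → Strategy p → (ℕ → Vertex G) → Set
  LegalPlay σ r = ∀ i →
    ReachableAvoiding (cops σ r i ∩ cops σ r (suc i)) (r i) (r (suc i)) ×
    ThreeEdgeConnected (r i) (r (suc i))

  Caught : ℕ → Subset (size G) → Vertex G → Set
  Caught q F r = ∣ (λ v → ThreeEdgeConnected r v × ReachableAvoiding F r v) ∣≤ q

  Winning : ∀ {p} → ℕ → Strategy p → Set
  Winning q σ = ∀ r → LegalPlay σ r →
    ∃[ i ] Caught q (cops σ r (suc i)) (r (suc i))

Searchable : Graph → ℕ → ℕ → Set
Searchable G p q = Σ[ σ ∈ Game.Strategy G p ] Game.Winning G q σ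

{-# OPTIONS --safe #-}

-- For a set W of vertices let δ(W) be the set of edges leaving W; call W thin if
-- |δ(W)| ≤ 2.  By Menger's theorem, vertices that no thin set separates are
-- 3-edge-connected.
--
-- If G has a decomposition of width at most k, the cops occupy adh(t) for a node t
-- and move towards the robber.  A thin edge of the tree does not separate her from
-- her class, so the edge traversed is bold whenever it matters and guarded in both
-- rounds, and she can never return across it.
--
-- For the converse, consider families ℬ of vertex sets that are closed under
-- supersets, and decompositions in which the sets outside ℬ are admitted as leaves.
-- By induction on |ℬ| there is either such a decomposition or a winning strategy for
-- the robber; the theorem is the case of the family of all nonempty sets.
--
-- If ℬ has disjoint members A and B, choose them minimal and apply the induction
-- hypothesis to ℬ ∖ {A} and ℬ ∖ {B}.  Unless this gives what is wanted, there are
-- decompositions with A and B as their only leaves in ℬ.  Take X ⊇ A disjoint from B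
-- with |δ(X)| minimum.  By submodularity, A can be enlarged to X in the first, and B
-- to the complement of X in the second, without increasing the width; then they can
-- be glued together along δ(X).
--
-- Otherwise the members of ℬ intersect pairwise.  If neither side of some thin cut
-- is in ℬ, that cut is a decomposition.  If not, the vertices contained in every thin
-- member of ℬ form a core whose elements are pairwise 3-edge-connected, and the rest
-- of the graph is covered by disjoint thin sets outside ℬ.  If for some F with
-- |F| ≤ k the component of G - F in ℬ contains at most k vertices of the core, these
-- are the bag of a node whose branches are the other components and the thin sets.
-- If there is no such F, the robber always moves to a vertex of the core in the
-- component of G - F in ℬ: two such components intersect, so the move is legal.

module Submission where

open import Algebra.Properties.CommutativeSemigroup using (interchange)
open import Data.Bool using (Bool; true; false; not; _∧_; _∨_; _xor_; if_then_else_)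
open import Data.Bool.Properties using
  ( not-involutive; not-injective; ¬-not; ∧-comm; ∧-zeroʳ; ∧-identityʳ; ∨-comm; ∨-zeroʳ; ∨-identityʳ
  ; xor-comm; xor-same) renaming (_≟_ to _≟ᵇ_)
open import Data.Empty using (⊥)
open import Data.Fin using (Fin; zero; suc)
open import Data.Fin.Properties using (_≟_; any?; all?; injective⇒≤; +↔⊎; 1↔⊤; 0↔⊥)
open import Data.Fin.Subset using (Subset; inside; outside; ∣_∣; ⁅_⁆)
  renaming (_∈_ to _∈ˢ_; _∉_ to _∉ˢ_; ⊥ to ∅)
open import Data.Fin.Subset.Properties
  using (p⊆q⇒∣p∣≤∣q∣; anySubset?; x∈p∩q⁻; x∈p∩q⁺; x∈⁅x⁆; x∈⁅y⁆⇒x≡y; ∣⊥∣≡0)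
  renaming (_∈?_ to _∈ˢ?_)
open import Data.Integer as ℤ using (ℤ; 0ℤ) renaming (+_ to pos)
import Data.Integer.Properties as ℤ
open import Data.Integer.Tactic.RingSolver using (solve-∀)
open import Data.List using (List; []; _∷_; _++_; length; map; filter; allFin) renaming (lookup to lookupˡ)
open import Data.List.Membership.Propositional using (_∈_; _∉_; lose; find)
open import Data.List.Membership.Propositional.Properties 
  using (∈-filter⁺; ∈-filter⁻; ∈-allFin; ∈-map⁺; ∈-++⁺ˡ; ∈-++⁺ʳ; ∈-lookup)
open import Data.List.Relation.Unary.All using (All; []; _∷_)
import Data.List.Relation.Unary.All as All
import Data.List.Relation.Unary.All.Properties as All
open import Data.List.Relation.Unary.Any using (Any; here; there)
import Data.List.Relation.Unary.Any as Any
open import Data.List.Properties using (filter-notAll)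
open import Data.List.Relation.Unary.AllPairs using (AllPairs; []; _∷_)
open import Data.List.Relation.Unary.Unique.Propositional using (Unique)
open import Data.Maybe using (Maybe; just; nothing) renaming (map to mapᵐ)
open import Data.Maybe.Properties using (just-injective) renaming (≡-dec to ≡ᵐ-dec)
open import Data.Nat using (ℕ; zero; suc; _+_; _≤_; _<_; z≤n; s≤s; s≤s⁻¹; _≤?_; _<?_)
open import Data.Nat.Properties using
  ( ≤-refl; ≤-trans; ≤-reflexive; +-mono-≤; +-monoʳ-≤; +-monoˡ-≤; m≤n+m; ≰⇒>; ≮⇒≥; <⇒≱
  ; module ≤-Reasoning
  ; +-suc; +-commutativeSemigroup; +-identityʳ; +-cancelʳ-≤; +-cancelˡ-≤; n≤1+n; <⇒≤)
open import Data.Product using (Σ-syntax; ∃-syntax; _×_; _,_; proj₁; proj₂; uncurry)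
open import Data.Product.Properties using (≡-dec)
open import Data.Sum using (_⊎_; inj₁; inj₂; [_,_]′)
open import Data.Unit using (⊤; tt)
open import Data.Vec using (Vec; []; _∷_; lookup; tabulate; head)
open import Data.Vec.Properties using (lookup∘tabulate; tabulate∘lookup; tabulate-cong; []=⇒lookup; lookup⇒[]=)
  renaming (≡-dec to ≡ˢ-dec)
open import Data.Sum.Function.Propositional using (_⊎-↔_)
open import Data.Sum.Properties using (inj₁-injective; inj₂-injective)
open import Function using (_∘_; id; _⇔_; mk⇔; _↔_; module Inverse; case_of_)
open import Function.Properties.Inverse using (↔-sym; ↔-trans)
open import Level using (0ℓ)
open import Relation.Binary.PropositionalEquality
  using (_≡_; _≢_; _≗_; refl; sym; trans; cong; cong₂; subst; subst₂; module ≡-Reasoning)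
open import Relation.Nullary using (¬_; Dec; yes; no; does; contradiction)
open import Relation.Nullary.Decidable
  using (_×-dec_; _⊎-dec_; ¬?; map′; dec-true; dec-false; decidable-stable; from-yes; _→-dec_)
open import Relation.Unary using (Pred; Decidable; _≐_)
open import Defs

-- Booleans and the sizes of finite sets.

from-does : ∀ {a} {P : Set a} (d : Dec P) → does d ≡ true → P
from-does (yes p) _ = p

from-¬does : ∀ {a} {P : Set a} (d : Dec P) → does d ≡ false → ¬ P
from-¬does (no ¬p) _ = ¬p

true≢false : true ≢ false
true≢false ()

_⊑_ : ∀ {n} → (Fin n → Bool) → (Fin n → Bool) → Set
X ⊑ Y = ∀ x → X x ≡ true → Y x ≡ true

bit : Bool → ℕ
bit true  = 1
bit false = 0

# : ∀ {n} → (Fin n → Bool) → ℕ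
# {zero}  f = 0
# {suc n} f = bit (f zero) + # (f ∘ suc)

-- Inequalities between sums of two cuts, such as submodularity, are reduced by this to a comparison
-- for each single edge.
#-mono₂ : ∀ {n} (a b c d : Fin n → Bool) →
          (∀ e → bit (a e) + bit (b e) ≤ bit (c e) + bit (d e)) →
          # a + # b ≤ # c + # d
#-mono₂ {zero}  a b c d le = z≤n
#-mono₂ {suc n} a b c d le = begin
  (bit (a zero) + # (a ∘ suc)) + (bit (b zero) + # (b ∘ suc)) ≡⟨ interchange +-commutativeSemigroup (bit (a zero)) _ _ _ ⟩
  (bit (a zero) + bit (b zero)) + (# (a ∘ suc) + # (b ∘ suc))
    ≤⟨ +-mono-≤ (le zero) (#-mono₂ (a ∘ suc) (b ∘ suc) (c ∘ suc) (d ∘ suc) (le ∘ suc)) ⟩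
  (bit (c zero) + bit (d zero)) + (# (c ∘ suc) + # (d ∘ suc)) ≡⟨ interchange +-commutativeSemigroup (bit (c zero)) _ _ _ ⟩
  (bit (c zero) + # (c ∘ suc)) + (bit (d zero) + # (d ∘ suc)) ∎
  where open ≤-Reasoning

bit-mono : ∀ {x y} → (x ≡ true → y ≡ true) → bit x ≤ bit y
bit-mono {false}         _ = z≤n
bit-mono {true}  {true}  _ = ≤-refl
bit-mono {true}  {false} h = contradiction (h refl) λ ()

#-mono : ∀ {n} {a b : Fin n → Bool} → a ⊑ b → # a ≤ # b
#-mono {zero}  le = z≤n
#-mono {suc n} le = +-mono-≤ (bit-mono (le zero)) (#-mono (le ∘ suc))

#-cong : ∀ {n} {a b : Fin n → Bool} → a ≗ b → # a ≡ # b
#-cong {zero}  eq = refl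
#-cong {suc n} eq = cong₂ _+_ (cong bit (eq zero)) (#-cong (eq ∘ suc))

#-strict : ∀ {n} {a b : Fin n → Bool} → a ⊑ b → ∀ x → a x ≡ false → b x ≡ true → # a < # b
#-strict {a = a} {b} le zero    ax bx rewrite ax | bx = s≤s (#-mono (le ∘ suc))
#-strict {a = a} {b} le (suc x) ax bx =
  ≤-trans (≤-reflexive (sym (+-suc (bit (a zero)) _)))
          (+-mono-≤ (bit-mono (le zero)) (#-strict (le ∘ suc) x ax bx))

#-positive : ∀ {n} {a : Fin n → Bool} x → a x ≡ true → 1 ≤ # a
#-positive x ax = ≤-trans (s≤s z≤n) (#-strict {a = λ _ → false} (λ _ ()) x refl ax)

#-bounded : ∀ {n} (a : Fin n → Bool) → # a ≤ n
#-bounded {zero}  a = z≤n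
#-bounded {suc n} a = +-mono-≤ (bit≤1 (a zero)) (#-bounded (a ∘ suc))
  where
  bit≤1 : ∀ x → bit x ≤ 1
  bit≤1 true  = ≤-refl
  bit≤1 false = z≤n

∣tabulate∣ : ∀ {n} (f : Fin n → Bool) → ∣ tabulate f ∣ ≡ # f
∣tabulate∣ {zero}  f = refl
∣tabulate∣ {suc n} f with f zero
... | true  = cong suc (∣tabulate∣ (f ∘ suc))
... | false = ∣tabulate∣ (f ∘ suc)

∣lookup∣ : ∀ {n} (S : Subset n) → # (lookup S) ≡ ∣ S ∣
∣lookup∣ S = trans (sym (∣tabulate∣ (lookup S))) (cong ∣_∣ (tabulate∘lookup S))

∈-tabulate⁺ : ∀ {n} {f : Fin n → Bool} {x} → f x ≡ true → x ∈ˢ tabulate f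
∈-tabulate⁺ {f = f} {x} eq = lookup⇒[]= x _ (trans (lookup∘tabulate f x) eq)

∈-tabulate⁻ : ∀ {n} {f : Fin n → Bool} {x} → x ∈ˢ tabulate f → f x ≡ true
∈-tabulate⁻ {f = f} {x} x∈ = trans (sym (lookup∘tabulate f x)) ([]=⇒lookup x∈)

module _ {n} {P : Pred (Fin n) 0ℓ} (P? : Decidable P) where

  ⟦_⟧ : Fin n → Bool
  ⟦_⟧ x = does (P? x)

  realise : (_∈ˢ tabulate ⟦_⟧) ≐ P
  realise = (λ {x} x∈ → from-does (P? x) (∈-tabulate⁻ x∈)) , (λ {x} p → ∈-tabulate⁺ (dec-true (P? x) p))

  bounded-by : ∀ {k} (f : Fin n → Bool) → (∀ x → P x → f x ≡ true) → # f ≤ k → ∣ P ∣≤ k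
  bounded-by f sub f≤k = tabulate ⟦_⟧ , realise ,
    ≤-trans (≤-reflexive (∣tabulate∣ ⟦_⟧)) (≤-trans (#-mono (λ x eq → sub x (from-does (P? x) eq))) f≤k)

three-distinct : ∀ {n} {f : Fin n → Bool} {x y z} → x ≢ y → x ≢ z → y ≢ z →
                 f x ≡ true → f y ≡ true → f z ≡ true → 3 ≤ # f
three-distinct {n} {f} {x} {y} {z} x≢y x≢z y≢z fx fy fz =
  ≤-trans (s≤s (≤-trans (s≤s (#-positive {a = g₁} x (dec-true (x ≟ x) refl)))
    (#-strict {a = g₁} {g₂} (λ w h → from₁ w h) y (dec-false (x ≟ y) x≢y) g₂y)))
    (#-strict {a = g₂} {f} g₂⊑f z g₂z fz)
  where
  g₁ g₂ : Fin n → Bool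
  g₁ w = does (x ≟ w)
  g₂ w = does (x ≟ w) ∨ does (y ≟ w)
  from₁ : ∀ w → g₁ w ≡ true → g₂ w ≡ true
  from₁ w h rewrite h = refl
  g₂y : g₂ y ≡ true
  g₂y rewrite dec-false (x ≟ y) x≢y = dec-true (y ≟ y) refl
  g₂z : g₂ z ≡ false
  g₂z rewrite dec-false (x ≟ z) x≢z = dec-false (y ≟ z) y≢z
  g₂⊑f : g₂ ⊑ f
  g₂⊑f w h with x ≟ w | y ≟ w
  ... | yes refl | _        = fx
  ... | no _     | yes refl = fy

-- Chains of a relation and reachability.

module _ {n} {ℓ} {R : Fin n → Fin n → Set ℓ} where

  infixr 5 _◂_

  data Chain : Fin n → Fin n → Set ℓ where
    ε   : ∀ {x} → Chain x x
    _◂_ : ∀ {x y z} → R x y → Chain y z → Chain x z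

  visits : ∀ {x y} → Chain x y → List (Fin n)
  visits {x} ε       = x ∷ []
  visits {x} (_ ◂ p) = x ∷ visits p

  start∈visits : ∀ {x y} (p : Chain x y) → x ∈ visits p
  start∈visits ε       = here refl
  start∈visits (_ ◂ _) = here refl

  chain-++ : ∀ {x y z} → Chain x y → Chain y z → Chain x z
  chain-++ ε       q = q
  chain-++ (r ◂ p) q = r ◂ chain-++ p q

  chain-reverse : (∀ {x y} → R x y → R y x) → ∀ {x y} → Chain x y → Chain y x
  chain-reverse symm ε       = ε
  chain-reverse symm (r ◂ p) = chain-++ (chain-reverse symm p) (symm r ◂ ε)

  chain-preserves : (S : Fin n → Bool) → (∀ {x y} → R x y → S x ≡ true → S y ≡ true) →
                    ∀ {x y} → Chain x y → S x ≡ true → S y ≡ true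
  chain-preserves S closed ε       sx = sx
  chain-preserves S closed (r ◂ p) sx = chain-preserves S closed p (closed r sx)

  private
    suffix : ∀ {x y u} (p : Chain x y) → Unique (visits p) → u ∈ visits p →
             Σ[ q ∈ Chain u y ] Unique (visits q)
    suffix ε       un       (here refl) = ε , un
    suffix (r ◂ p) un       (here refl) = r ◂ p , un
    suffix (r ◂ p) (_ ∷ un) (there u∈)  = suffix p un u∈

  -- Loops are removed from the end backwards: if the start recurs in the simplified rest,
  -- everything before that recurrence is dropped.
  simplify : ∀ {x y} → Chain x y → Σ[ q ∈ Chain x y ] Unique (visits q)
  simplify ε = ε , [] ∷ []
  simplify {x} (r ◂ p) with simplify p
  ... | q , un with Any.any? (x ≟_) (visits q)
  ...   | yes x∈ = suffix q un x∈
  ...   | no x∉  = r ◂ q , All.¬Any⇒All¬ _ x∉ ∷ un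

chain-map : ∀ {n ℓ ℓ′} {R : Fin n → Fin n → Set ℓ} {R′ : Fin n → Fin n → Set ℓ′} →
            (∀ {x y} → R x y → R′ x y) → ∀ {x y} → Chain {R = R} x y → Chain {R = R′} x y
chain-map f ε       = ε
chain-map f (r ◂ p) = f r ◂ chain-map f p

module Closure {n : ℕ} (R : Fin n → Fin n → Set) (R? : ∀ x y → Dec (R x y)) (u : Fin n) where

  record Reached : Set where
    field
      set    : Fin n → Bool
      start  : set u ≡ true
      sound  : ∀ x → set x ≡ true → Chain {R = R} u x
      closed : ∀ {x y} → R x y → set x ≡ true → set y ≡ true

  private
    grow : ∀ fuel (S : Fin n → Bool) → S u ≡ true → (∀ x → S x ≡ true → Chain {R = R} u x) →
           n < # S + fuel → Reached
    -- Every extension of `S` uses one unit of fuel and gains an element, so running out of fuel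
    -- would mean more than `n` elements.
    grow zero S start sound lt = contradiction (#-bounded S) (<⇒≱ (subst (n <_) (+-identityʳ _) lt))
    grow (suc fuel) S start sound lt
      with any? (λ x → any? (λ y → (S x ≟ᵇ true) ×-dec (S y ≟ᵇ false) ×-dec R? x y))
    ... | no none = record
      { set = S ; start = start ; sound = sound
      ; closed = λ {x} {y} r sx → ¬-not (λ sy → none (x , y , sx , sy , r)) }
    ... | yes (x , y , sx , sy , r) = grow fuel S′ (S⊑S′ u start) sound′
        (≤-trans lt (≤-trans (≤-reflexive (+-suc _ fuel)) (+-monoˡ-≤ fuel (#-strict S⊑S′ y sy S′y))))
      where
      S′ : Fin n → Bool
      S′ z = S z ∨ does (y ≟ z)
      S⊑S′ : S ⊑ S′
      S⊑S′ z sz rewrite sz = refl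
      S′y : S′ y ≡ true
      S′y rewrite sy = dec-true (y ≟ y) refl
      sound′ : ∀ z → S′ z ≡ true → Chain u z
      sound′ z h with S z in eq | y ≟ z
      ... | true  | _        = sound z eq
      ... | false | yes refl = chain-++ (sound x sx) (r ◂ ε)

  reached : Reached
  reached = grow n (λ z → does (u ≟ z)) (dec-true (u ≟ u) refl)
    (λ x eq → subst (Chain u) (from-does (u ≟ x) eq) ε)
    (+-monoˡ-≤ n (#-positive u (dec-true (u ≟ u) refl)))

  chain? : ∀ v → Dec (Chain {R = R} u v)
  chain? v with Reached.set reached v in eq
  ... | true  = yes (Reached.sound reached v eq)
  ... | false = no λ p → true≢false
    (trans (sym (chain-preserves (Reached.set reached) (Reached.closed reached) p (Reached.start reached))) eq)

-- Set difference, choice and enumeration for finite sets.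

#-witness : ∀ {n} {f : Fin n → Bool} → 0 < # f → ∃[ x ] f x ≡ true
#-witness {suc n} {f} 0<f with f zero in eq
... | true  = zero , eq
... | false with #-witness {n} {f ∘ suc} 0<f
...   | x , fx = suc x , fx

#-empty : ∀ {n} {f : Fin n → Bool} → (∀ x → f x ≡ false) → # f ≡ 0
#-empty {zero}  none = refl
#-empty {suc n} none rewrite none zero = #-empty (none ∘ suc)

every? : ∀ {P : Bool → Set} → (∀ b → Dec (P b)) → Dec (∀ b → P b)
every? P? = map′ (λ { (t , f) true → t ; (t , f) false → f }) (λ h → h true , h false)
                 (P? true ×-dec P? false)

_∖_ : ∀ {n} → (Fin n → Bool) → (Fin n → Bool) → Fin n → Bool
(X ∖ Y) v = X v ∧ not (Y v)

∖-⊑ : ∀ {n} (X Y : Fin n → Bool) → (X ∖ Y) ⊑ X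
∖-⊑ X Y v h with X v
... | true = refl

∖-∉ : ∀ {n} (X Y : Fin n → Bool) v → (X ∖ Y) v ≡ true → Y v ≡ false
∖-∉ X Y v h with X v | Y v
... | true | false = refl

∈-∖ : ∀ {n} (X Y : Fin n → Bool) v → X v ≡ true → Y v ≡ false → (X ∖ Y) v ≡ true
∈-∖ X Y v p q rewrite p | q = refl

⊑-∉ : ∀ {n} {X Y : Fin n → Bool} → X ⊑ Y → ∀ v → Y v ≡ false → X v ≡ false
⊑-∉ {X = X} X⊑Y v yv = ¬-not (λ xv → true≢false (trans (sym (X⊑Y v xv)) yv))

∧-leftᵗ : ∀ {a b} → a ∧ b ≡ true → a ≡ true
∧-leftᵗ {true} _ = refl

∧-rightᵗ : ∀ {a b} → a ∧ b ≡ true → b ≡ true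
∧-rightᵗ {true} h = h

not-∨ : ∀ a b → not (a ∨ b) ≡ not a ∧ not b
not-∨ true  b = refl
not-∨ false b = refl

⊑-antisym : ∀ {n} {X Y : Fin n → Bool} → X ⊑ Y → Y ⊑ X → X ≗ Y
⊑-antisym {X = X} {Y} X⊑Y Y⊑X v with X v in Xv | Y v in Yv
... | true  | true  = refl
... | false | false = refl
... | true  | false = contradiction (trans (sym (X⊑Y v Xv)) Yv) true≢false
... | false | true  = contradiction (trans (sym (Y⊑X v Yv)) Xv) true≢false

-- The choice depends only on the values of the predicate (`first-cong`), so it yields one canonical
-- representative for each component.
first : ∀ {n} → (Fin n → Bool) → Maybe (Fin n)
first {zero}  P = nothing
first {suc n} P = if P zero then just zero else mapᵐ suc (first (P ∘ suc))

first-cong : ∀ {n} {P Q : Fin n → Bool} → P ≗ Q → first P ≡ first Q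
first-cong {zero}  eq = refl
first-cong {suc n} eq = cong₂ (λ b m → if b then just zero else mapᵐ suc m)
                              (eq zero) (first-cong (eq ∘ suc))

first-just : ∀ {n} (P : Fin n → Bool) x → P x ≡ true → ∃[ y ] first P ≡ just y × P y ≡ true
first-just {suc n} P x Px with P zero in eq
first-just {suc n} P x       Px | true  = zero , refl , eq
first-just {suc n} P zero    Px | false = contradiction (trans (sym Px) eq) true≢false
first-just {suc n} P (suc x) Px | false with first-just (P ∘ suc) x Px
... | y , found , Py rewrite found = suc y , refl , Py

first-sound : ∀ {n} (P : Fin n → Bool) {x} → first P ≡ just x → P x ≡ true
first-sound {suc n} P found with P zero in eq
first-sound {suc n} P refl  | true  = eq
first-sound {suc n} P found | false with first (P ∘ suc) in rest
first-sound {suc n} P refl  | false | just y = first-sound (P ∘ suc) rest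

subsets : ∀ n → List (Subset n)
subsets zero    = [] ∷ []
subsets (suc n) = map (inside ∷_) (subsets n) ++ map (outside ∷_) (subsets n)

∈-subsets : ∀ {n} (S : Subset n) → S ∈ subsets n
∈-subsets []            = here refl
∈-subsets (inside ∷ S)  = ∈-++⁺ˡ (∈-map⁺ (inside ∷_) (∈-subsets S))
∈-subsets (outside ∷ S) = ∈-++⁺ʳ (map (inside ∷_) (subsets _)) (∈-map⁺ (outside ∷_) (∈-subsets S))

module _ {n} {P : Pred (Fin n) 0ℓ} (P? : Decidable P) where

  at-least? : ∀ k → Dec (k ≤∣ P ∣)
  at-least? k = map′
    (λ le → tabulate ⟦ P? ⟧ , realise P? , ≤-trans le (≤-reflexive (sym (∣tabulate∣ ⟦ P? ⟧))))
    (λ (S , (S⊆P , _) , le) → ≤-trans le (≤-trans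
      (p⊆q⇒∣p∣≤∣q∣ (λ x∈ → proj₂ (realise P?) (S⊆P x∈))) (≤-reflexive (∣tabulate∣ ⟦ P? ⟧))))
    (k ≤? # ⟦ P? ⟧)

  size-of : ∀ {k} (f : Fin n → Bool) → (∀ x → P x → f x ≡ true) → k ≤∣ P ∣ → k ≤ # f
  size-of f sub (S , (S⊆P , _) , le) = ≤-trans le (≤-trans (≤-reflexive (sym (∣lookup∣ S)))
    (#-mono (λ x h → sub x (S⊆P (lookup⇒[]= x S h)))))

xor-≢ : ∀ {a b} → a ≢ b → a xor b ≡ true
xor-≢ {true}  {true}  ne = contradiction refl ne
xor-≢ {true}  {false} ne = refl
xor-≢ {false} {true}  ne = refl
xor-≢ {false} {false} ne = contradiction refl ne

xor-not : ∀ a b → not a xor not b ≡ a xor b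
xor-not true  b = refl
xor-not false b = not-involutive b

-- Routes, walks and cuts in a graph.

module GraphProperties (G : Graph) where
  open Graph G public

  src tgt : Edge → Vertex
  src e = proj₁ (ends e)
  tgt e = proj₂ (ends e)

  joins-ends : ∀ e → Joins e (src e) (tgt e)
  joins-ends e = inj₁ refl

  joins-sym : ∀ {e u v} → Joins e u v → Joins e v u
  joins-sym (inj₁ eq) = inj₂ eq
  joins-sym (inj₂ eq) = inj₁ eq

  joins? : ∀ e u v → Dec (Joins e u v)
  joins? e u v = ≡-dec _≟_ _≟_ (ends e) (u , v) ⊎-dec ≡-dec _≟_ _≟_ (ends e) (v , u)

  joins-unique : ∀ {e u v x y} → Joins e u v → Joins e x y → (u ≡ x × v ≡ y) ⊎ (u ≡ y × v ≡ x)
  joins-unique (inj₁ p) (inj₁ q) with refl ← trans (sym p) q = inj₁ (refl , refl)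
  joins-unique (inj₁ p) (inj₂ q) with refl ← trans (sym p) q = inj₂ (refl , refl)
  joins-unique (inj₂ p) (inj₁ q) with refl ← trans (sym p) q = inj₂ (refl , refl)
  joins-unique (inj₂ p) (inj₂ q) with refl ← trans (sym p) q = inj₁ (refl , refl)

  joins-src : ∀ {e u v} → Joins e u v → (src e ≡ u × tgt e ≡ v) ⊎ (src e ≡ v × tgt e ≡ u)
  joins-src = joins-unique (inj₁ refl)

  Step : ∀ {ℓ} → (Edge → Set ℓ) → Vertex → Vertex → Set ℓ
  Step Q u v = Σ[ e ∈ Edge ] Joins e u v × Q e

  step-sym : ∀ {ℓ} {Q : Edge → Set ℓ} {u v} → Step Q u v → Step Q v u
  step-sym (e , J , q) = e , joins-sym J , q

  step? : ∀ {Q : Edge → Set} → Decidable Q → ∀ u v → Dec (Step Q u v)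
  step? Q? u v = any? (λ e → joins? e u v ×-dec Q? e)

  -- A walk that carries, for each edge, the evidence for `Q`. Being a chain, it can be decided by
  -- `Closure` whenever `Q` is decidable.
  Route : ∀ {ℓ} → (Edge → Set ℓ) → Vertex → Vertex → Set ℓ
  Route Q = Chain {R = Step Q}

  route-sym : ∀ {ℓ} {Q : Edge → Set ℓ} {u v} → Route Q u v → Route Q v u
  route-sym = chain-reverse step-sym

  route-map : ∀ {ℓ ℓ′} {Q : Edge → Set ℓ} {Q′ : Edge → Set ℓ′} → (∀ {e} → Q e → Q′ e) →
              ∀ {u v} → Route Q u v → Route Q′ u v
  route-map f = chain-map (λ (e , J , q) → e , J , f q)

  module _ {ℓ} {Q : Edge → Set ℓ} where

    route→walk : ∀ {u v} → Route Q u v → Walk u v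
    route→walk ε             = stop
    route→walk ((e , J , _) ◂ p) = step e J (route→walk p)

    route→walk-vertices : ∀ {u v} (p : Route Q u v) → walkVertices (route→walk p) ≡ visits p
    route→walk-vertices ε       = refl
    route→walk-vertices {u} (_ ◂ p) = cong (u ∷_) (route→walk-vertices p)

    route→walk-edges : ∀ {u v} (p : Route Q u v) → All Q (walkEdges (route→walk p))
    route→walk-edges ε                 = []
    route→walk-edges ((_ , _ , q) ◂ p) = q ∷ route→walk-edges p

    route→path : ∀ {u v} → Route Q u v → Σ[ p ∈ Path u v ] All Q (edges p)
    route→path r with simplify r
    ... | q , un = (route→walk q , subst Unique (sym (route→walk-vertices q)) un) , route→walk-edges q

    walk→route : ∀ {u v} (w : Walk u v) → All Q (walkEdges w) → Route Q u v
    walk→route stop         []       = ε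
    walk→route (step e J w) (q ∷ qs) = (e , J , q) ◂ walk→route w qs

  walk→path : ∀ {u v} (w : Walk u v) → Σ[ p ∈ Path u v ] (∀ {e} → e ∈ edges p → e ∈ walkEdges w)
  walk→path w with route→path (walk→route w (All.tabulate {P = _∈ walkEdges w} id))
  ... | p , all = p , All.lookup all

  module _ (F : Subset size) where

    reach→route : ∀ {u v} → ReachableAvoiding F u v → Route (_∉ˢ F) u v
    reach→route ((w , _) , avoid) = walk→route w avoid

    route? : ∀ u v → Dec (Route (_∉ˢ F) u v)
    route? u = Closure.chain? (Step (_∉ˢ F)) (step? (λ e → ¬? (e ∈ˢ? F))) u

    reach? : ∀ u v → Dec (ReachableAvoiding F u v)
    reach? u v = map′ route→path reach→route (route? u v)

  cross : (Vertex → Bool) → Edge → Bool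
  cross X e = X (src e) xor X (tgt e)

  cut : (Vertex → Bool) → ℕ
  cut X = # (cross X)

  cross-joins : ∀ X {e u v} → Joins e u v → cross X e ≡ X u xor X v
  cross-joins X {e} J with joins-src {e} J
  ... | inj₁ (refl , refl) = refl
  ... | inj₂ (refl , refl) = xor-comm (X (src e)) (X (tgt e))

  walk-crosses : ∀ X {u v} (w : Walk u v) → X u ≢ X v → ∃[ e ] e ∈ walkEdges w × cross X e ≡ true
  walk-crosses X stop ne = contradiction refl ne
  walk-crosses X (step {u} {v} e J w) ne with X u ≟ᵇ X v
  ... | no ne′ = e , here refl , trans (cross-joins X J) (xor-≢ ne′)
  ... | yes eq with walk-crosses X w (λ h → ne (trans eq h))
  ...   | e′ , e′∈ , c = e′ , there e′∈ , c

  -- Three edge-disjoint paths between the two sides of `X` contribute three distinct crossing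
  -- edges.
  separated : ∀ X {u v} → ThreeEdgeConnected u v → cut X ≤ 2 → X u ≡ X v
  separated X (inj₁ refl) _ = refl
  separated X {u} {v} (inj₂ (p , q , r , pq , pr , qr)) thin with X u ≟ᵇ X v
  ... | yes eq = eq
  ... | no ne with walk-crosses X (proj₁ p) ne | walk-crosses X (proj₁ q) ne | walk-crosses X (proj₁ r) ne
  ...   | e , e∈ , ce | f , f∈ , cf | g , g∈ , cg = contradiction thin (<⇒≱ (three-distinct {f = cross X}
            (λ { refl → pq (e∈ , f∈) }) (λ { refl → pr (e∈ , g∈) }) (λ { refl → qr (f∈ , g∈) }) ce cf cg))

-- Finite sums of integers.

∑ : ∀ {n} → (Fin n → ℤ) → ℤ
∑ {zero}  t = 0ℤ
∑ {suc n} t = t zero ℤ.+ ∑ (t ∘ suc)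

∑-cong : ∀ {n} {s t : Fin n → ℤ} → s ≗ t → ∑ s ≡ ∑ t
∑-cong {zero}  eq = refl
∑-cong {suc n} eq = cong₂ ℤ._+_ (eq zero) (∑-cong (eq ∘ suc))

∑-update : ∀ {n} (s t : Fin n → ℤ) i → (∀ j → j ≢ i → t j ≡ s j) → ∑ t ≡ ∑ s ℤ.+ (t i ℤ.- s i)
∑-update s t zero agree
  rewrite ∑-cong {s = t ∘ suc} {s ∘ suc} (λ j → agree (suc j) λ ()) = shift (t zero) (s zero) (∑ (s ∘ suc))
  where
  shift : ∀ a b c → a ℤ.+ c ≡ (b ℤ.+ c) ℤ.+ (a ℤ.- b)
  shift = solve-∀
∑-update s t (suc i) agree
  rewrite agree zero (λ ()) | ∑-update (s ∘ suc) (t ∘ suc) i (λ j j≢i → agree (suc j) (j≢i ∘ λ { refl → refl }))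
  = sym (ℤ.+-assoc (s zero) _ _)

∑-nonpositive : ∀ {n} (t : Fin n → ℤ) → (∀ i → t i ℤ.≤ 0ℤ) → ∑ t ℤ.≤ 0ℤ
∑-nonpositive {zero}  t neg = ℤ.≤-refl
∑-nonpositive {suc n} t neg = ℤ.+-mono-≤ (neg zero) (∑-nonpositive (t ∘ suc) (neg ∘ suc))

∑-bits : ∀ {n} (b : Fin n → Bool) → ∑ (λ i → pos (bit (b i))) ≡ pos (# b)
∑-bits {zero}  b = refl
∑-bits {suc n} b rewrite ∑-bits (b ∘ suc) = refl

-- Menger's theorem for three edge-disjoint paths, by augmenting flows.

module Menger (G : Graph) where
  open GraphProperties G

  -- The flow through an undirected edge of capacity one, relative to the order in which `ends`
  -- lists its endpoints.
  data Use : Set where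
    idle along against : Use

  idle? : ∀ u → Dec (u ≡ idle)
  idle? idle    = yes refl
  idle? along   = no λ ()
  idle? against = no λ ()

  Flow : Set
  Flow = Edge → Use

  [_]ℤ : Bool → ℤ
  [ b ]ℤ = pos (bit b)

  -- The net amount that leaves `X` when one unit is sent from `x` to `y`; such terms telescope
  -- along a path.
  δ : (Vertex → Bool) → Vertex → Vertex → ℤ
  δ X x y = [ X x ]ℤ ℤ.- [ X y ]ℤ

  term : (Vertex → Bool) → Edge → Use → ℤ
  term X e idle    = 0ℤ
  term X e along   = δ X (src e) (tgt e)
  term X e against = δ X (tgt e) (src e)

  net : Flow → (Vertex → Bool) → ℤ
  net f X = ∑ (λ e → term X e (f e))

  -- Conservation is required of every vertex set at once, which avoids summing
  -- over the vertices of a set.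
  Value : ℕ → Vertex → Vertex → Flow → Set
  Value j u v f = ∀ X → net f X ≡ pos j ℤ.* δ X u v

  infixl 6 _[_≔_]

  _[_≔_] : Flow → Edge → Use → Flow
  (f [ e ≔ u ]) d = if does (e ≟ d) then u else f d

  at : ∀ f e u → (f [ e ≔ u ]) e ≡ u
  at f e u rewrite dec-true (e ≟ e) refl = refl

  off : ∀ f {e d} u → e ≢ d → (f [ e ≔ u ]) d ≡ f d
  off f {e} {d} u ne rewrite dec-false (e ≟ d) ne = refl

  net-update : ∀ f e u X → net (f [ e ≔ u ]) X ≡ net f X ℤ.+ (term X e u ℤ.- term X e (f e))
  net-update f e u X = trans
    (∑-update (λ d → term X d (f d)) (λ d → term X d ((f [ e ≔ u ]) d)) e
      (λ d d≢e → cong (term X d) (off f u (d≢e ∘ sym))))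
    (cong (λ w → net f X ℤ.+ (term X e w ℤ.- term X e (f e))) (at f e u))

  -- One more unit along or against an edge; a unit in the other direction is cancelled. The values
  -- `raise along` and `lower against` are placeholders, excluded by the hypotheses of `term-raise`
  -- and `term-lower`.
  raise lower : Use → Use
  raise idle    = along
  raise along   = along
  raise against = idle
  lower idle    = against
  lower along   = idle
  lower against = against

  term-raise : ∀ X e u → u ≢ along → term X e (raise u) ℤ.- term X e u ≡ δ X (src e) (tgt e)
  term-raise X e idle    _  = ℤ.+-identityʳ _
  term-raise X e along   ne = contradiction refl ne
  term-raise X e against _  = flip [ X (src e) ]ℤ [ X (tgt e) ]ℤ
    where
    flip : ∀ a b → 0ℤ ℤ.- (b ℤ.- a) ≡ a ℤ.- b
    flip = solve-∀

  term-lower : ∀ X e u → u ≢ against → term X e (lower u) ℤ.- term X e u ≡ δ X (tgt e) (src e)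
  term-lower X e idle    _  = ℤ.+-identityʳ _
  term-lower X e along   _  = flip [ X (src e) ]ℤ [ X (tgt e) ]ℤ
    where
    flip : ∀ a b → 0ℤ ℤ.- (a ℤ.- b) ≡ b ℤ.- a
    flip = solve-∀
  term-lower X e against ne = contradiction refl ne

  -- The residual digraph: an edge in use can still be traversed against its flow, which cancels it.
  Residual : Flow → Vertex → Vertex → Set
  Residual f x y = Σ[ e ∈ Edge ]
    ((ends e ≡ (x , y) × f e ≢ along) ⊎ (ends e ≡ (y , x) × f e ≢ against))

  residual? : ∀ f x y → Dec (Residual f x y)
  residual? f x y = any? λ e →
    (≡-dec _≟_ _≟_ (ends e) (x , y) ×-dec ¬? (along? (f e))) ⊎-dec
    (≡-dec _≟_ _≟_ (ends e) (y , x) ×-dec ¬? (against? (f e)))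
    where
    along? : ∀ u → Dec (u ≡ along)
    along? idle    = no λ ()
    along? along   = yes refl
    along? against = no λ ()
    against? : ∀ u → Dec (u ≡ against)
    against? idle    = no λ ()
    against? along   = no λ ()
    against? against = yes refl

  AgreesOff : List Vertex → Flow → Flow → Set
  AgreesOff vs f f′ = ∀ e {a b} → Joins e a b → a ∉ vs → f′ e ≡ f e

  -- The rest of the path is augmented first. Since the path does not return to `x`, this changes no
  -- edge at `x`, and the first edge is still residual.
  augment : ∀ {f x y} (p : Chain {R = Residual f} x y) → Unique (visits p) →
            Σ[ f′ ∈ Flow ] (∀ X → net f′ X ≡ net f X ℤ.+ δ X x y) × AgreesOff (visits p) f f′
  augment {f} {x} ε _ = f , (λ X → zero-δ (net f X) [ X x ]ℤ) , (λ _ _ _ → refl)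
    where
    zero-δ : ∀ a b → a ≡ a ℤ.+ (b ℤ.- b)
    zero-δ = solve-∀
  augment {f} {x} {y} (_◂_ {y = z} (e , res) p) (x∉ ∷ un) with augment p un
  ... | f′ , net′ , agree = extend res
    where
    same : ∀ {b} → Joins e x b → f′ e ≡ f e
    same J = agree e J (All.All¬⇒¬Any x∉)
    extend-by : ∀ u → Joins e x z → (∀ X → term X e u ℤ.- term X e (f′ e) ≡ δ X x z) →
                Σ[ f″ ∈ Flow ] (∀ X → net f″ X ≡ net f X ℤ.+ δ X x y) × AgreesOff (x ∷ visits p) f f″
    extend-by u J gain = f′ [ e ≔ u ] , net″ , agree″
      where
      net″ : ∀ X → net (f′ [ e ≔ u ]) X ≡ net f X ℤ.+ δ X x y
      net″ X rewrite net-update f′ e u X | gain X | net′ X = chain-δ (net f X) [ X x ]ℤ [ X z ]ℤ [ X y ]ℤ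
        where
        chain-δ : ∀ n a b c → n ℤ.+ (b ℤ.- c) ℤ.+ (a ℤ.- b) ≡ n ℤ.+ (a ℤ.- c)
        chain-δ = solve-∀
      agree″ : AgreesOff (x ∷ visits p) f (f′ [ e ≔ u ])
      agree″ d J′ a∉ = trans (off f′ u e≢d) (agree d J′ (a∉ ∘ there))
        where
        e≢d : e ≢ d
        e≢d refl with joins-unique {e} J J′
        ... | inj₁ (refl , _) = a∉ (here refl)
        ... | inj₂ (_ , refl) = a∉ (there (start∈visits p))
    extend : (ends e ≡ (x , z) × f e ≢ along) ⊎ (ends e ≡ (z , x) × f e ≢ against) → _
    extend (inj₁ (refl , ne)) = extend-by (raise (f′ e)) (inj₁ refl)
      (λ X → term-raise X e (f′ e) (ne ∘ trans (sym (same (inj₁ refl)))))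
    extend (inj₂ (refl , ne)) = extend-by (lower (f′ e)) (inj₂ refl)
      (λ X → term-lower X e (f′ e) (ne ∘ trans (sym (same (inj₂ refl)))))

  module _ {u v : Vertex} (u≢v : u ≢ v) where

    -- No residual arc leaves `X`, so every crossing edge carries a unit outwards and the net flow
    -- out of `X` counts them all.
    saturated : ∀ {j f X} → Value j u v f → X u ≡ true → X v ≡ false →
                (∀ {x y} → Residual f x y → X x ≡ true → X y ≡ true) → cut X ≡ j
    saturated {j} {f} {X} val xu xv closed = ℤ.+-injective (begin
      pos (# (cross X))                ≡⟨ ∑-bits (cross X) ⟨
      ∑ (λ e → [ cross X e ]ℤ)     ≡⟨ ∑-cong full ⟨
      net f X                      ≡⟨ val X ⟩
      pos j ℤ.* δ X u v              ≡⟨ cong₂ (λ a b → pos j ℤ.* ([ a ]ℤ ℤ.- [ b ]ℤ)) xu xv ⟩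
      pos j ℤ.* pos 1                  ≡⟨ ℤ.*-identityʳ (pos j) ⟩
      pos j                          ∎)
      where
      open ≡-Reasoning
      same-side : ∀ (a : Bool) w e → X (src e) ≡ a → X (tgt e) ≡ a → term X e w ≡ 0ℤ
      same-side a idle    e p q = refl
      same-side a along   e p q rewrite p | q = ℤ.+-inverseʳ [ a ]ℤ
      same-side a against e p q rewrite p | q = ℤ.+-inverseʳ [ a ]ℤ
      outward : ∀ w e → X (src e) ≡ true → X (tgt e) ≡ false → (w ≢ along → X (tgt e) ≡ true) →
                term X e w ≡ pos 1
      outward along   e p q h rewrite p | q = refl
      outward idle    e p q h = contradiction (trans (sym (h λ ())) q) true≢false
      outward against e p q h = contradiction (trans (sym (h λ ())) q) true≢false
      inward : ∀ w e → X (src e) ≡ false → X (tgt e) ≡ true → (w ≢ against → X (src e) ≡ true) →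
               term X e w ≡ pos 1
      inward against e p q h rewrite p | q = refl
      inward idle    e p q h = contradiction (trans (sym (h λ ())) p) true≢false
      inward along   e p q h = contradiction (trans (sym (h λ ())) p) true≢false
      full : ∀ e → term X e (f e) ≡ [ cross X e ]ℤ
      full e with X (src e) in p | X (tgt e) in q
      ... | true  | true  = same-side true (f e) e p q
      ... | false | false = same-side false (f e) e p q
      ... | true  | false = outward (f e) e p q (λ ne → closed (e , inj₁ (refl , ne)) p)
      ... | false | true  = inward (f e) e p q (λ ne → closed (e , inj₂ (refl , ne)) q)

    augment-or-cut : ∀ {j f} → Value j u v f →
      (Σ[ f′ ∈ Flow ] Value (suc j) u v f′) ⊎
      (Σ[ X ∈ (Vertex → Bool) ] X u ≡ true × X v ≡ false × cut X ≡ j)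
    augment-or-cut {j} {f} val = decide (Reached.set reached v) refl
      where
      open Closure (Residual f) (residual? f) u
      open Reached
      decide : ∀ b → set reached v ≡ b → _
      decide true eq with simplify (sound reached v eq)
      ... | p , un with augment p un
      ...   | f′ , net′ , _ = inj₁ (f′ , λ X → trans (net′ X) (trans (cong (ℤ._+ δ X u v) (val X))
                (one-more (pos j) (δ X u v))))
        where
        one-more : ∀ a b → a ℤ.* b ℤ.+ b ≡ (pos 1 ℤ.+ a) ℤ.* b
        one-more = solve-∀
      decide false eq = inj₂ (set reached , start reached , eq ,
        saturated {f = f} {X = set reached} val (start reached) eq (closed reached))

    Leaving : Flow → Vertex → Edge → Set
    Leaving f x e = (f e ≡ along × src e ≡ x) ⊎ (f e ≡ against × tgt e ≡ x)

    used : Flow → ℕ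
    used f = # (λ e → not (does (idle? (f e))))

    -- One unit on its way from `x` to `v`, together with `j` units from `u` to `v`: the invariant
    -- while a path is peeled off.
    Between : ℕ → Vertex → Flow → Set
    Between j x f = ∀ X → net f X ≡ δ X x v ℤ.+ pos j ℤ.* δ X u v

    leave : ∀ {j x f} → x ≢ v → Between j x f → ∃[ e ] Leaving f x e
    leave {j} {x} {f} x≢v val with any? (λ e → leaving? e (f e))
      where
      leaving? : ∀ e w → Dec ((w ≡ along × src e ≡ x) ⊎ (w ≡ against × tgt e ≡ x))
      leaving? e idle = no λ { (inj₁ ()) ; (inj₂ ()) }
      leaving? e along = map′ (λ p → inj₁ (refl , p)) (λ { (inj₁ (_ , p)) → p }) (src e ≟ x)
      leaving? e against = map′ (λ p → inj₂ (refl , p)) (λ { (inj₂ (_ , p)) → p }) (tgt e ≟ x)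
    ... | yes found = found
    ... | no none = contradiction (∑-nonpositive _ nonpositive) (ℤ.<⇒≱ positive)
      where
      -- Conservation is applied to the set consisting of `x` alone. Its net outflow is positive,
      -- but if no flow left `x`, every term would be nonpositive.
      X : Vertex → Bool
      X z = does (x ≟ z)
      no-gain : ∀ a b → a ≢ x → δ X a b ℤ.≤ 0ℤ
      no-gain a b a≢x rewrite dec-false (x ≟ a) (a≢x ∘ sym) with X b
      ... | true  = ℤ.-≤+
      ... | false = ℤ.≤-refl
      nonpositive : ∀ e → term X e (f e) ℤ.≤ 0ℤ
      nonpositive e with f e in eq
      ... | idle    = ℤ.≤-refl
      ... | along   = no-gain _ _ (λ p → none (e , inj₁ (eq , p)))
      ... | against = no-gain _ _ (λ p → none (e , inj₂ (eq , p)))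
      positive : 0ℤ ℤ.< net f X
      positive rewrite val X | dec-true (x ≟ x) refl | dec-false (x ≟ v) x≢v with X u
      ... | true  rewrite ℤ.*-identityʳ (pos j) = ℤ.+<+ (s≤s z≤n)
      ... | false rewrite ℤ.*-zeroʳ (pos j) = ℤ.+<+ (s≤s z≤n)

    record Peeled (j : ℕ) (x : Vertex) (f : Flow) : Set where
      field
        walk    : Walk x v
        rest    : Flow
        value   : Value j u v rest
        along-f : ∀ {e} → e ∈ walkEdges walk → f e ≢ idle
        cleared : ∀ {e} → e ∈ walkEdges walk → rest e ≡ idle
        within  : ∀ {e} → rest e ≢ idle → f e ≢ idle

    -- Each step clears the edge it traverses, so the number of used edges bounds the number of
    -- steps, and all traversed edges are idle in the remaining flow. The walk may revisit vertices;
    -- `walk→path` shortens it later.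
    peel-from : ∀ fuel {j x f} → used f ≤ fuel → Between j x f → Peeled j x f
    peel-step : ∀ fuel {j x f} e y → Joins e x y → used f ≤ fuel → f e ≢ idle →
                (∀ X → term X e (f e) ≡ δ X x y) → Between j x f → Peeled j x f

    peel-from fuel {j} {x} {f} le val with x ≟ v
    ... | yes refl = record
      { walk = stop ; rest = f ; value = λ X → trans (val X) (drop [ X v ]ℤ _)
      ; along-f = λ () ; cleared = λ () ; within = id }
      where
      drop : ∀ a b → (a ℤ.- a) ℤ.+ b ≡ b
      drop = solve-∀
    ... | no x≢v with leave {j} {x} {f} x≢v val
    ...   | e , inj₁ (eq , refl) = peel-step fuel e (tgt e) (inj₁ refl) le (λ h → case trans (sym eq) h of λ ())
              (λ X → cong (term X e) eq) val
    ...   | e , inj₂ (eq , refl) = peel-step fuel e (src e) (inj₂ refl) le (λ h → case trans (sym eq) h of λ ())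
              (λ X → cong (term X e) eq) val

    peel-step fuel {j} {x} {f} e y J le busy gain val = go fuel le
      where
      f₁ : Flow
      f₁ = f [ e ≔ idle ]
      within₁ : ∀ {d} → f₁ d ≢ idle → f d ≢ idle
      within₁ {d} ne with e ≟ d
      ... | yes refl = busy
      ... | no e≢d   = ne
      val₁ : Between j y f₁
      val₁ X rewrite net-update f e idle X | gain X | val X = move [ X x ]ℤ [ X y ]ℤ [ X v ]ℤ _
        where
        move : ∀ a b c d → ((a ℤ.- c) ℤ.+ d) ℤ.+ (0ℤ ℤ.- (a ℤ.- b)) ≡ (b ℤ.- c) ℤ.+ d
        move = solve-∀
      fewer : used f₁ < used f
      fewer = #-strict (λ d h → cong not (dec-false (idle? (f d)) (within₁ {d} (λ q → case trans (sym h) (cong not (dec-true (idle? (f₁ d)) q)) of λ ()))))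
                e (cong not (dec-true (idle? (f₁ e)) (at f e idle))) (cong not (dec-false (idle? (f e)) busy))
      go : ∀ fuel → used f ≤ fuel → Peeled j x f
      go zero       le = contradiction (≤-trans fewer le) λ ()
      go (suc fuel) le = record
        { walk = step e J walk ; rest = rest ; value = value
        ; along-f = λ { (here refl) → busy ; (there d∈) → within₁ (along-f d∈) }
        ; cleared = λ { (here refl) → decidable-stable (idle? (rest e)) (λ ne → within ne (at f e idle))
                      ; (there d∈) → cleared d∈ }
        ; within = within₁ ∘ within }
        where open Peeled (peel-from fuel {j} {y} {f₁} (s≤s⁻¹ (≤-trans fewer le)) val₁)

    peel : ∀ {j f} → Value (suc j) u v f → Peeled j u f
    peel {j} {f} val = peel-from (used f) ≤-refl (λ X → trans (val X) (one-off (pos j) (δ X u v)))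
      where
      one-off : ∀ a b → (pos 1 ℤ.+ a) ℤ.* b ≡ b ℤ.+ a ℤ.* b
      one-off = solve-∀

    -- A walk uses only edges busy in the flow from which it is peeled, and an edge once cleared
    -- stays idle. Hence the three walks, and the paths inside them, are edge-disjoint.
    decompose : ∀ f → Value 3 u v f → ThreeEdgeConnected u v
    decompose f val₃ = inj₂ (proj₁ p , proj₁ q , proj₁ r ,
        (λ (a , b) → apart₁ (proj₂ p a) (P₂.along-f (proj₂ q b))) ,
        (λ (a , b) → apart₁ (proj₂ p a) (P₂.within (P₃.along-f (proj₂ r b)))) ,
        (λ (a , b) → P₃.along-f (proj₂ r b) (P₂.cleared (proj₂ q a))))
      where
      module P₁ = Peeled (peel {2} {f} val₃)
      module P₂ = Peeled (peel {1} {P₁.rest} P₁.value)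
      module P₃ = Peeled (peel {0} {P₂.rest} P₂.value)
      p = walk→path P₁.walk
      q = walk→path P₂.walk
      r = walk→path P₃.walk
      apart₁ : ∀ {e} → e ∈ walkEdges P₁.walk → ¬ P₁.rest e ≢ idle
      apart₁ e∈ ne = ne (P₁.cleared e∈)

  ThinlySeparated : Vertex → Vertex → Set
  ThinlySeparated u v = Σ[ X ∈ (Vertex → Bool) ] X u ≡ true × X v ≡ false × cut X ≤ 2

  -- Three augmentations of the zero flow suffice; a failure at value `j`, which is at most 2,
  -- exhibits a cut of exactly `j` edges.
  menger : ∀ u v → ThreeEdgeConnected u v ⊎ ThinlySeparated u v
  menger u v with u ≟ v
  ... | yes u≡v = inj₁ (inj₁ u≡v)
  ... | no u≢v with augment-or-cut u≢v {0} {λ _ → idle} (λ X → ∑-zero size)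
    where
    ∑-zero : ∀ n → ∑ {n} (λ _ → 0ℤ) ≡ 0ℤ
    ∑-zero zero    = refl
    ∑-zero (suc n) = trans (ℤ.+-identityˡ _) (∑-zero n)
  ...   | inj₂ (X , xu , xv , eq) = inj₂ (X , xu , xv , subst (_≤ 2) (sym eq) z≤n)
  ...   | inj₁ (f₁ , val₁) with augment-or-cut u≢v {1} {f₁} val₁
  ...     | inj₂ (X , xu , xv , eq) = inj₂ (X , xu , xv , subst (_≤ 2) (sym eq) (s≤s z≤n))
  ...     | inj₁ (f₂ , val₂) with augment-or-cut u≢v {2} {f₂} val₂
  ...       | inj₂ (X , xu , xv , eq) = inj₂ (X , xu , xv , ≤-reflexive eq)
  ...       | inj₁ (f₃ , val₃) = inj₁ (decompose u≢v f₃ val₃)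

  threeEdgeConnected? : ∀ u v → Dec (ThreeEdgeConnected u v)
  threeEdgeConnected? u v with menger u v
  ... | inj₁ con                  = yes con
  ... | inj₂ (X , xu , xv , thin) = no λ con →
          true≢false (trans (sym xu) (trans (separated X con thin) xv))

-- Cut inequalities, and the local structure of a decomposition at a node.

module Splits (G : Graph) (k : ℕ) where
  open GraphProperties G

  VSet : Set
  VSet = Vertex → Bool

  ∁ : VSet → VSet
  ∁ X v = not (X v)

  cut-cong : ∀ {X Y} → X ≗ Y → cut X ≡ cut Y
  cut-cong eq = #-cong (λ e → cong₂ _xor_ (eq (src e)) (eq (tgt e)))

  cut-∁ : ∀ X → cut (∁ X) ≡ cut X
  cut-∁ X = #-cong (λ e → xor-not (X (src e)) (X (tgt e)))

  cut-empty : ∀ {X} → (∀ v → X v ≡ false) → cut X ≡ 0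
  cut-empty none = #-empty (λ e → cong₂ _xor_ (none (src e)) (none (tgt e)))

  cut-posimodular : ∀ X Y → cut (X ∖ Y) + cut (Y ∖ X) ≤ cut X + cut Y
  cut-posimodular X Y = #-mono₂ (cross (X ∖ Y)) (cross (Y ∖ X)) (cross X) (cross Y)
      (λ e → table (X (src e)) (X (tgt e)) (Y (src e)) (Y (tgt e)))
    where
    table : ∀ a b c d → bit ((a ∧ not c) xor (b ∧ not d)) + bit ((c ∧ not a) xor (d ∧ not b)) ≤
                        bit (a xor b) + bit (c xor d)
    -- For a single edge the inequality depends on four truth values, and all sixteen cases are
    -- evaluated.
    table = from-yes (every? λ a → every? λ b → every? λ c → every? λ d →
      bit ((a ∧ not c) xor (b ∧ not d)) + bit ((c ∧ not a) xor (d ∧ not b)) ≤? bit (a xor b) + bit (c xor d))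

  cut-submodular : ∀ X Y → cut (λ v → X v ∨ Y v) + cut (λ v → X v ∧ Y v) ≤ cut X + cut Y
  cut-submodular X Y = #-mono₂ (cross (λ v → X v ∨ Y v)) (cross (λ v → X v ∧ Y v)) (cross X) (cross Y)
      (λ e → table (X (src e)) (X (tgt e)) (Y (src e)) (Y (tgt e)))
    where
    table : ∀ a b c d → bit ((a ∨ c) xor (b ∨ d)) + bit ((a ∧ c) xor (b ∧ d)) ≤
                        bit (a xor b) + bit (c xor d)
    table = from-yes (every? λ a → every? λ b → every? λ c → every? λ d →
      bit ((a ∨ c) xor (b ∨ d)) + bit ((a ∧ c) xor (b ∧ d)) ≤? bit (a xor b) + bit (c xor d))

  -- The local structure of a tree-cut decomposition at a node t: one label for
  -- the bag of t, and one for each branch at t.  Branches with an uncounted label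
  -- hang off a thin edge.
  record Split : Set₁ where
    infix 4 _≟ˡ_
    field
      Label    : Set
      _≟ˡ_     : (l m : Label) → Dec (l ≡ m)
      labels   : List Label
      complete : ∀ l → l ∈ labels
      bag      : Label
      colour   : Vertex → Label
      counted  : Label → Bool
      uncounted-bag : counted bag ≡ false

    part : Label → VSet
    part l v = does (colour v ≟ˡ l)

    counts-between : Label → Label → Bool
    counts-between l m = not (does (l ≟ˡ m)) ∧ (counted l ∨ counted m)

    -- An upper bound for the adhesion of the node: by `thin`, bold tree edges belong to counted
    -- branches, and by `cross-counts` all edges leaving such a branch are included.
    counts : Edge → Bool
    counts e = counts-between (colour (src e)) (colour (tgt e))

    field
      few  : # counts ≤ k
      thin : ∀ l → l ≢ bag → counted l ≡ false → cut (part l) ≤ 2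

    in-part : ∀ {l v} → colour v ≡ l → part l v ≡ true
    in-part {l} {v} eq = dec-true (colour v ≟ˡ l) eq

    part-colour : ∀ {l v} → part l v ≡ true → colour v ≡ l
    part-colour {l} {v} = from-does (colour v ≟ˡ l)

    not-in-part : ∀ {l v} → colour v ≢ l → part l v ≡ false
    not-in-part {l} {v} = dec-false (colour v ≟ˡ l)

    parts-disjoint : ∀ {l m} → l ≢ m → ∀ v → part l v ≡ true → part m v ≡ false
    parts-disjoint l≢m v p = not-in-part (λ q → l≢m (trans (sym (part-colour p)) q))

    cross-counts : ∀ l → counted l ≡ true → cross (part l) ⊑ counts
    cross-counts l cl e h with colour (src e) ≟ˡ l | colour (tgt e) ≟ˡ l
    cross-counts l cl e h | yes refl | no ne  rewrite dec-false (l ≟ˡ colour (tgt e)) (ne ∘ sym) | cl = refl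
    cross-counts l cl e h | no ne | yes refl rewrite dec-false (colour (src e) ≟ˡ l) ne | cl with counted (colour (src e))
    ... | true  = refl
    ... | false = refl

    part-cut : ∀ l → l ≢ bag → cut (part l) ≤ 2 ⊎ cut (part l) ≤ k
    part-cut l l≢bag with counted l in eq
    ... | true  = inj₂ (≤-trans (#-mono (cross-counts l eq)) few)
    ... | false = inj₁ (thin l l≢bag eq)

  module Recolour (s : Split) (X : VSet) (o : Split.Label s) where
    open Split s

    colour′ : Vertex → Label
    colour′ v = if X v then o else colour v

    part′ : Label → VSet
    part′ l v = does (colour′ v ≟ˡ l)

    inCounted : VSet
    inCounted v = counted (colour v)

    part′-other : ∀ l → l ≢ o → part′ l ≗ part l ∖ X
    part′-other l l≢o v with X v
    ... | true  = trans (dec-false (o ≟ˡ l) (l≢o ∘ sym)) (sym (∧-zeroʳ _))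
    ... | false = sym (∧-identityʳ _)

    part′-self : part′ o ≗ λ v → part o v ∨ X v
    part′-self v with X v
    ... | true  = trans (dec-true (o ≟ˡ o) refl) (sym (∨-zeroʳ _))
    ... | false = sym (∨-identityʳ _)

    -- Submodularity for splits: colouring X by o does not create counted edges if X
    -- has minimum cut among the sets it is compared with.  For uncounted o that
    -- comparison must be with X minus the counted branches, not with X ∩ part o.
    private
      _⊕_ : Label → Label → ℕ
      l ⊕ m = bit (counts-between l m)

      ⊕-self : ∀ l → l ⊕ l ≡ 0
      ⊕-self l rewrite dec-true (l ≟ˡ l) refl = refl

      ⊕-≤1 : ∀ l m → l ⊕ m ≤ 1
      ⊕-≤1 l m with counts-between l m
      ... | true  = ≤-refl
      ... | false = z≤n

      ⊕-≢ : ∀ {l m} → l ≢ m → l ⊕ m ≡ bit (counted l ∨ counted m)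
      ⊕-≢ {l} {m} l≢m rewrite dec-false (l ≟ˡ m) l≢m = refl

      ⊕-sym : ∀ l m → l ⊕ m ≡ m ⊕ l
      ⊕-sym l m with l ≟ˡ m
      ... | yes refl = sym (⊕-self l)
      ... | no ne    = trans (cong bit (∨-comm (counted l) (counted m))) (sym (⊕-≢ (ne ∘ sym)))

    module _ (co : counted o ≡ true) where
      private
        is-o : Label → Bool
        is-o l = does (l ≟ˡ o)

        both : ∀ l m → bit (is-o l xor is-o m) ≤ l ⊕ m
        both l m with l ≟ˡ o | m ≟ˡ o
        ... | yes refl | yes refl = z≤n
        ... | no _     | no _     = z≤n
        ... | yes refl | no ne    rewrite ⊕-≢ (ne ∘ sym) | co = ≤-refl
        ... | no ne    | yes refl rewrite ⊕-≢ ne | co | ∨-zeroʳ (counted l) = ≤-refl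

        one : ∀ l m → o ⊕ m + bit (is-o l) ≤ l ⊕ m + 1
        one l m with l ≟ˡ o
        ... | yes refl = ≤-refl
        ... | no _     = ≤-trans (≤-reflexive (+-identityʳ _)) (≤-trans (⊕-≤1 o m) (m≤n+m 1 _))

        -- The inequality for one edge, whose ends have labels `l` and `m`; `a` and `b` tell whether
        -- they lie in `X`.
        edge-counted : ∀ a b l m → (if a then o else l) ⊕ (if b then o else m)
                         + bit ((a ∧ is-o l) xor (b ∧ is-o m)) ≤ l ⊕ m + bit (a xor b)
        edge-counted true  true  l m rewrite ⊕-self o | +-identityʳ (l ⊕ m) = both l m
        edge-counted true  false l m rewrite xor-comm (is-o l) false = one l m
        edge-counted false true  l m rewrite ⊕-sym l o | ⊕-sym l m = one m l
        edge-counted false false l m = ≤-refl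

      recolour-counted : # (λ e → counts-between (colour′ (src e)) (colour′ (tgt e)))
                           + cut (λ v → X v ∧ part o v) ≤ # counts + cut X
      recolour-counted = #-mono₂ _ (cross (λ v → X v ∧ part o v)) counts (cross X)
        (λ e → edge-counted (X (src e)) (X (tgt e)) (colour (src e)) (colour (tgt e)))

    module _ (co : counted o ≡ false) where
      private
        both : ∀ l m → bit (not (counted l) xor not (counted m)) ≤ l ⊕ m
        both l m with l ≟ˡ m
        ... | yes refl rewrite xor-same (not (counted l)) = z≤n
        ... | no _ with counted l | counted m
        ...   | true  | true  = z≤n
        ...   | true  | false = ≤-refl
        ...   | false | true  = ≤-refl
        ...   | false | false = z≤n

        one : ∀ l m → o ⊕ m + bit (not (counted l)) ≤ l ⊕ m + 1
        one l m = by-left (counted l) refl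
          where
          by-right : counted l ≡ false → ∀ b → counted m ≡ b → o ⊕ m ≤ l ⊕ m
          by-right cl true  cm = ≤-trans (⊕-≤1 o m) (≤-reflexive (sym
            (trans (⊕-≢ (λ { refl → true≢false (trans (sym cm) cl) })) (cong₂ (λ a b → bit (a ∨ b)) cl cm))))
          by-right cl false cm rewrite co | cm | ∧-zeroʳ (not (does (o ≟ˡ m))) = z≤n
          by-left : ∀ b → counted l ≡ b → o ⊕ m + bit (not b) ≤ l ⊕ m + 1
          by-left true  cl = ≤-trans (≤-reflexive (+-identityʳ _)) (≤-trans (⊕-≤1 o m) (m≤n+m 1 _))
          by-left false cl = +-monoˡ-≤ 1 (by-right cl (counted m) refl)

        edge-uncounted : ∀ a b l m → (if a then o else l) ⊕ (if b then o else m)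
                           + bit ((a ∧ not (counted l)) xor (b ∧ not (counted m))) ≤ l ⊕ m + bit (a xor b)
        edge-uncounted true  true  l m rewrite ⊕-self o | +-identityʳ (l ⊕ m) = both l m
        edge-uncounted true  false l m rewrite xor-comm (not (counted l)) false = one l m
        edge-uncounted false true  l m rewrite ⊕-sym l o | ⊕-sym l m = one m l
        edge-uncounted false false l m = ≤-refl

      recolour-uncounted : # (λ e → counts-between (colour′ (src e)) (colour′ (tgt e)))
                             + cut (X ∖ inCounted) ≤ # counts + cut X
      recolour-uncounted = #-mono₂ _ (cross (X ∖ inCounted)) counts (cross X)
        (λ e → edge-uncounted (X (src e)) (X (tgt e)) (colour (src e)) (colour (tgt e)))

    module _ (tight-counted   : counted o ≡ true  → cut X ≤ cut (λ v → X v ∧ part o v))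
             (tight-uncounted : counted o ≡ false → cut X ≤ cut (X ∖ inCounted))
             (thin′ : ∀ l → l ≢ bag → counted l ≡ false → cut (part′ l) ≤ 2) where

      recolour : Split
      recolour = record
        { Label = Label ; _≟ˡ_ = _≟ˡ_ ; labels = labels ; complete = complete ; bag = bag
        ; colour = colour′ ; counted = counted ; uncounted-bag = uncounted-bag
        ; few = ≤-trans fewer few ; thin = thin′ }
        where
        fewer : # (λ e → counts-between (colour′ (src e)) (colour′ (tgt e))) ≤ # counts
        fewer with counted o in co
        ... | true  = +-cancelʳ-≤ (cut X) _ _ (≤-trans (+-monoʳ-≤ _ (tight-counted refl)) (recolour-counted co))
        ... | false = +-cancelʳ-≤ (cut X) _ _ (≤-trans (+-monoʳ-≤ _ (tight-uncounted refl)) (recolour-uncounted co))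

-- Partial decompositions: shrinking, re-rooting and gluing.

module Duality (G : Graph) (k : ℕ) where
  open GraphProperties G
  open Menger G using (menger)
  open Splits G k

  Family : Set
  Family = List (Subset order)

  infix 4 _∈ᶠ_ _∉ᶠ_ _∈ᶠ?_

  _∈ᶠ_ _∉ᶠ_ : VSet → Family → Set
  X ∈ᶠ ℬ = tabulate X ∈ ℬ
  X ∉ᶠ ℬ = tabulate X ∉ ℬ

  _∈ᶠ?_ : ∀ X ℬ → Dec (X ∈ᶠ ℬ)
  X ∈ᶠ? ℬ = Any.any? (≡ˢ-dec _≟ᵇ_ (tabulate X)) ℬ

  ∈ᶠ-cong : ∀ {ℬ X Y} → X ≗ Y → X ∈ᶠ ℬ → Y ∈ᶠ ℬ
  ∈ᶠ-cong eq = subst (_∈ _) (tabulate-cong eq)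

  ∈ᶠ-lookup : ∀ {ℬ S} → S ∈ ℬ → lookup S ∈ᶠ ℬ
  ∈ᶠ-lookup {S = S} = subst (_∈ _) (sym (tabulate∘lookup S))

  -- A rooted piece of a tree-cut decomposition, covering W.  A leaf is any set
  -- outside ℬ; the label o of a split stands for the branch containing the root.
  data Sol (ℬ : Family) (W : VSet) : Set₁ where
    leaf : W ∉ᶠ ℬ → cut W ≤ 2 ⊎ cut W ≤ k → Sol ℬ W
    node : (s : Split) (o : Split.Label s) → # (Split.part s (Split.bag s)) ≤ k →
           o ≢ Split.bag s → W ≗ ∁ (Split.part s o) →
           (∀ l → l ≢ Split.bag s → l ≢ o → Sol ℬ (Split.part s l)) → Sol ℬ W

  sol-resp : ∀ {ℬ W W′} → W ≗ W′ → Sol ℬ W → Sol ℬ W′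
  sol-resp eq (leaf W∉ c) =
    leaf (W∉ ∘ ∈ᶠ-cong (sym ∘ eq)) (subst (λ n → n ≤ 2 ⊎ n ≤ k) (cut-cong eq) c)
  sol-resp eq (node s o small o≢ W≗ ch) = node s o small o≢ (λ v → trans (sym (eq v)) (W≗ v)) ch

  sol-cut : ∀ {ℬ W} → Sol ℬ W → cut W ≤ 2 ⊎ cut W ≤ k
  sol-cut (leaf _ c) = c
  sol-cut {W = W} (node s o small o≢ W≗ ch) =
    subst (λ n → n ≤ 2 ⊎ n ≤ k) (sym (trans (cut-cong W≗) (cut-∁ (Split.part s o)))) (Split.part-cut s o o≢)

  UpClosed : Family → Set
  UpClosed ℬ = ∀ {X Y} → X ∈ᶠ ℬ → X ⊑ Y → Y ∈ᶠ ℬ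

  Inhabited : Family → Set
  Inhabited ℬ = ∀ {X} → X ∈ᶠ ℬ → ∃[ v ] X v ≡ true

  Intersecting : Family → Set
  Intersecting ℬ = ∀ {X Y} → X ∈ᶠ ℬ → Y ∈ᶠ ℬ → ∃[ v ] X v ≡ true × Y v ≡ true

  everything : VSet
  everything _ = true

  -- Every split is recoloured so that `X` joins the branch of the root. At every node this branch
  -- contains `A`, because `A` is outside `W`; so the sets with which `X` is compared contain `A`,
  -- and `tight` applies. Leaves only shrink, so they stay outside the up-closed `ℬ`.
  push : ∀ {ℬ} → UpClosed ℬ → (A X : VSet) → A ⊑ X → (∀ Y → A ⊑ Y → Y ⊑ X → cut X ≤ cut Y) →
         ∀ {W} → (∀ v → A v ≡ true → W v ≡ false) → Sol ℬ W → Sol ℬ (W ∖ X)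
  push {ℬ} up A X A⊑X tight = go
    where
    -- Posimodularity of `W` and `X`: since `X ∖ W` still contains `A`, its cut is at least that of
    -- `X`.
    shrink-cut : ∀ W → (∀ v → A v ≡ true → W v ≡ false) → cut (W ∖ X) ≤ cut W
    shrink-cut W A∩W = +-cancelʳ-≤ (cut X) _ _ (≤-trans (+-monoʳ-≤ (cut (W ∖ X))
      (tight (X ∖ W) (λ v a → ∈-∖ X W v (A⊑X v a) (A∩W v a)) (∖-⊑ X W))) (cut-posimodular W X))

    go : ∀ {W} → (∀ v → A v ≡ true → W v ≡ false) → Sol ℬ W → Sol ℬ (W ∖ X)
    go {W} A∩W (leaf W∉ c) = leaf (λ h → W∉ (up h (∖-⊑ W X)))
      ([ inj₁ ∘ ≤-trans (shrink-cut W A∩W) , inj₂ ∘ ≤-trans (shrink-cut W A∩W) ]′ c)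
    go {W} A∩W (node s o small o≢ W≗ ch) = node s′ o
        (≤-trans (#-mono (λ v h → ∖-⊑ (part bag) X v (trans (sym (part′-other bag (o≢ ∘ sym) v)) h))) small)
        o≢ W∖X≗
        (λ l l≢bag l≢o → sol-resp (λ v → sym (part′-other l l≢o v))
                           (go (λ v a → parts-disjoint (l≢o ∘ sym) v (A⊑o v a)) (ch l l≢bag l≢o)))
      where
      open Split s
      open Recolour s X o
      A⊑o : A ⊑ part o
      A⊑o v a = not-injective {part o v} {true} (trans (sym (W≗ v)) (A∩W v a))
      tight-o : cut X ≤ cut (λ v → X v ∧ part o v)
      tight-o = tight _ (λ v a → cong₂ _∧_ (A⊑X v a) (A⊑o v a))
                        (λ v h → ∧-leftᵗ {X v} h)
      thin′ : ∀ l → l ≢ bag → counted l ≡ false → cut (part′ l) ≤ 2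
      thin′ l l≢bag cl with l ≟ˡ o
      ... | no l≢o = ≤-trans (≤-reflexive (cut-cong (part′-other l l≢o)))
              (≤-trans (shrink-cut (part l) (λ v a → parts-disjoint (l≢o ∘ sym) v (A⊑o v a))) (thin l l≢bag cl))
      -- Submodularity of `part o` and `X`: their intersection contains `A`, so their union has no
      -- larger cut than `part o`.
      ... | yes refl = ≤-trans (≤-reflexive (cut-cong part′-self))
              (≤-trans (+-cancelʳ-≤ (cut X) _ _ (≤-trans (+-monoʳ-≤ (cut (λ v → part o v ∨ X v))
                  (≤-trans tight-o (≤-reflexive (cut-cong (λ v → ∧-comm (X v) (part o v))))))
                  (cut-submodular (part o) X)))
                (thin o l≢bag cl))
      s′ : Split
      s′ = recolour (λ _ → tight-o)
        (λ co → tight _ (λ v a → ∈-∖ X inCounted v (A⊑X v a)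
                            (trans (cong counted (part-colour (A⊑o v a))) co)) (∖-⊑ X inCounted))
        thin′
      W∖X≗ : W ∖ X ≗ ∁ (part′ o)
      W∖X≗ v = trans (cong (_∧ not (X v)) (W≗ v))
        (trans (sym (not-∨ (part o v) (X v))) (cong not (sym (part′-self v))))

  _∖ᶠ_ : Family → VSet → Family
  ℬ ∖ᶠ A = filter (λ S → ¬? (≡ˢ-dec _≟ᵇ_ S (tabulate A))) ℬ

  ∈-∖ᶠ : ∀ {ℬ A X} → X ∈ᶠ ℬ → tabulate X ≢ tabulate A → X ∈ᶠ ℬ ∖ᶠ A
  ∈-∖ᶠ {A = A} = ∈-filter⁺ (λ S → ¬? (≡ˢ-dec _≟ᵇ_ S (tabulate A)))

  tabulate-injective : ∀ {X Y : VSet} → tabulate X ≡ tabulate Y → X ≗ Y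
  tabulate-injective {X} {Y} eq v =
    trans (sym (lookup∘tabulate X v)) (trans (cong (λ S → lookup S v) eq) (lookup∘tabulate Y v))

  -- The branch containing `a` is followed, the only one in which `A` can be a leaf. If it is one,
  -- the result is a continuation: once a piece for the outside of `W` is supplied, the tree is
  -- turned so that `A` takes the place of the root side.
  reroot : ∀ {ℬ A a} → A a ≡ true → ∀ {W} → Sol (ℬ ∖ᶠ A) W →
           Sol ℬ W ⊎ (W a ≡ true × (Sol ℬ (∁ W) → Sol ℬ (∁ A)))
  reroot {ℬ} {A} {a} Aa {W} (leaf W∉ c) with W ∈ᶠ? ℬ
  ... | no W∉ℬ = inj₁ (leaf W∉ℬ c)
  ... | yes W∈ℬ with ≡ˢ-dec _≟ᵇ_ (tabulate W) (tabulate A)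
  ...   | yes eq = inj₂ (trans (tabulate-injective eq a) Aa , sol-resp (cong not ∘ tabulate-injective eq))
  ...   | no ne  = contradiction (∈-∖ᶠ W∈ℬ ne) W∉
  reroot {ℬ} {A} {a} Aa {W} (node s o small o≢ W≗ ch) = decide (o ≟ˡ m) (m ≟ˡ bag)
    where
    open Split s
    m : Label
    m = colour a
    plain : ∀ l (l≢bag : l ≢ bag) (l≢o : l ≢ o) → l ≢ m → Sol ℬ (part l)
    plain l l≢bag l≢o l≢m with reroot Aa (ch l l≢bag l≢o)
    ... | inj₁ sol       = sol
    ... | inj₂ (a∈l , _) = contradiction (sym (part-colour a∈l)) l≢m
    decide : Dec (o ≡ m) → Dec (m ≡ bag) → _
    decide (yes refl) _ = inj₁ (node s o small o≢ W≗ (λ l p q → plain l p q q))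
    decide _ (yes m≡bag) = inj₁ (node s o small o≢ W≗ (λ l p q → plain l p q (λ { refl → p m≡bag })))
    decide (no o≢m) (no m≢bag) with reroot Aa (ch m m≢bag (o≢m ∘ sym))
    ... | inj₁ sol = inj₁ (node s o small o≢ W≗ children)
      where
      children : ∀ l → l ≢ bag → l ≢ o → Sol ℬ (part l)
      children l p q with l ≟ˡ m
      ... | yes refl = sol
      ... | no l≢m   = plain l p q l≢m
    -- The branch `m` towards `A` takes over the role of `o`, and the old root branch `o` becomes a
    -- child.
    ... | inj₂ (_ , close) = inj₂
        ( trans (W≗ a) (cong not (not-in-part (o≢m ∘ sym)))
        , λ outside-W → close (node s m small m≢bag (λ _ → refl) (children outside-W)) )
      where
      children : Sol ℬ (∁ W) → ∀ l → l ≢ bag → l ≢ m → Sol ℬ (part l)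
      children outside-W l p q with l ≟ˡ o
      ... | yes refl = sol-resp (λ v → trans (cong not (W≗ v)) (not-involutive (part o v))) outside-W
      ... | no l≢o   = plain l p l≢o q

  -- The two pieces become branches at a new node with an empty bag, counted or not according to the
  -- bound that `sol-cut` provides. As nothing lies beyond the root, its branch `outerᵖ` is empty as
  -- well.
  glue : ∀ {ℬ X} → Sol ℬ X → Sol ℬ (∁ X) → Sol ℬ everything
  glue {ℬ} {X} inX outX = [ join-thin , join-counted ]′ (sol-cut inX)
    where
    pattern bagᵖ   = zero
    pattern outerᵖ = suc zero
    pattern inᵖ    = suc (suc zero)
    pattern outᵖ   = suc (suc (suc zero))
    colourᵖ : Vertex → Fin 4
    colourᵖ v = if X v then inᵖ else outᵖ
    countedᵖ : Bool → Fin 4 → Bool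
    countedᵖ b bagᵖ   = false
    countedᵖ b outerᵖ = false
    countedᵖ b inᵖ    = b
    countedᵖ b outᵖ   = b
    partᵖ : Fin 4 → VSet
    partᵖ l v = does (colourᵖ v ≟ l)
    part-bag : ∀ v → partᵖ bagᵖ v ≡ false
    part-bag v with X v
    ... | true  = refl
    ... | false = refl
    part-outer : ∀ v → partᵖ outerᵖ v ≡ false
    part-outer v with X v
    ... | true  = refl
    ... | false = refl
    part-in : ∀ v → X v ≡ partᵖ inᵖ v
    part-in v with X v
    ... | true  = refl
    ... | false = refl
    part-out : ∀ v → ∁ X v ≡ partᵖ outᵖ v
    part-out v with X v
    ... | true  = refl
    ... | false = refl
    countsᵖ : Bool → Edge → Bool
    countsᵖ b e = not (does (colourᵖ (src e) ≟ colourᵖ (tgt e)))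
                  ∧ (countedᵖ b (colourᵖ (src e)) ∨ countedᵖ b (colourᵖ (tgt e)))
    split : ∀ b → # (countsᵖ b) ≤ k → (b ≡ false → cut X ≤ 2) → Split
    split b few thin = record
      { Label = Fin 4 ; _≟ˡ_ = _≟_ ; labels = allFin 4 ; complete = ∈-allFin ; bag = bagᵖ
      ; colour = colourᵖ ; counted = countedᵖ b ; uncounted-bag = refl ; few = few
      ; thin = λ { bagᵖ ne _ → contradiction refl ne
                 ; outerᵖ _ _ → subst (_≤ 2) (sym (cut-empty part-outer)) z≤n
                 ; inᵖ _ eq → subst (_≤ 2) (cut-cong part-in) (thin eq)
                 ; outᵖ _ eq → subst (_≤ 2) (trans (sym (cut-∁ X)) (cut-cong part-out)) (thin eq) } }
    join : ∀ b few thin → Sol ℬ everything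
    join b few thin = node (split b few thin) outerᵖ (≤-trans (≤-reflexive (#-empty part-bag)) z≤n) (λ ())
      (λ v → cong not (sym (part-outer v)))
      (λ { bagᵖ ne _ → contradiction refl ne
         ; outerᵖ _ ne → contradiction refl ne
         ; inᵖ _ _ → sol-resp part-in inX
         ; outᵖ _ _ → sol-resp part-out outX })
    join-thin : cut X ≤ 2 → Sol ℬ everything
    join-thin thin = join false (≤-trans (≤-reflexive (#-empty none)) z≤n) (λ _ → thin)
      where
      none : ∀ e → countsᵖ false e ≡ false
      none e with X (src e) | X (tgt e)
      ... | true  | true  = refl
      ... | true  | false = refl
      ... | false | true  = refl
      ... | false | false = refl
    join-counted : cut X ≤ k → Sol ℬ everything
    join-counted le = join true (≤-trans (#-mono crossing) le) (λ ())
      where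
      crossing : countsᵖ true ⊑ cross X
      crossing e h with X (src e) | X (tgt e)
      ... | true  | false = refl
      ... | false | true  = refl
      ... | true  | true  = h
      ... | false | false = h

  Minimal : Family → VSet → Set
  Minimal ℬ A = ∀ {Y} → Y ∈ᶠ ℬ → Y ⊑ A → A ⊑ Y

  shrink : ∀ {ℬ} fuel X → # X ≤ fuel → X ∈ᶠ ℬ → Σ[ A ∈ VSet ] A ⊑ X × A ∈ᶠ ℬ × Minimal ℬ A
  shrink {ℬ} fuel X le X∈ with Any.any? smaller? ℬ
    where
    smaller? : ∀ S → Dec ((∀ v → lookup S v ≡ true → X v ≡ true) × ∃[ v ] lookup S v ≡ false × X v ≡ true)
    smaller? S = all? (λ v → (lookup S v ≟ᵇ true) →-dec (X v ≟ᵇ true))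
           ×-dec any? (λ v → (lookup S v ≟ᵇ false) ×-dec (X v ≟ᵇ true))
  ... | no none = X , (λ _ → id) , X∈ , λ {Y} Y∈ Y⊑X v Xv → ¬-not (λ Yv → none (lose Y∈
        ( (λ w h → Y⊑X w (trans (sym (lookup∘tabulate Y w)) h))
        , v , trans (lookup∘tabulate Y v) Yv , Xv)))
  ... | yes some with find some
  ...   | S , S∈ , S⊑X , v , v∉S , v∈X = descend fuel le
    where
    descend : ∀ fuel → # X ≤ fuel → Σ[ A ∈ VSet ] A ⊑ X × A ∈ᶠ ℬ × Minimal ℬ A
    descend zero       le = contradiction (≤-trans (#-strict S⊑X v v∉S v∈X) le) λ ()
    descend (suc fuel) le with shrink fuel (lookup S) (s≤s⁻¹ (≤-trans (#-strict S⊑X v v∉S v∈X) le)) (∈ᶠ-lookup S∈)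
    ... | A , A⊑S , A∈ , min = A , (λ w → S⊑X w ∘ A⊑S w) , A∈ , min

  module _ (A B : VSet) (A∩B : ∀ v → A v ≡ true → B v ≡ false) where

    Separates : VSet → Set
    Separates Y = A ⊑ Y × (∀ v → B v ≡ true → Y v ≡ false)

    private
      descend : ∀ fuel X → cut X ≤ fuel → Separates X →
                Σ[ X ∈ VSet ] Separates X × (∀ Y → Separates Y → cut X ≤ cut Y)
      descend fuel X le sep with anySubset? better?
        where
        better? : ∀ S → Dec (Separates (lookup S) × cut (lookup S) < cut X)
        better? S = (all? (λ v → (A v ≟ᵇ true) →-dec (lookup S v ≟ᵇ true))
                     ×-dec all? (λ v → (B v ≟ᵇ true) →-dec (lookup S v ≟ᵇ false)))
                    ×-dec (cut (lookup S) <? cut X)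
      ... | no none = X , sep , λ Y (A⊑Y , B∩Y) → ≮⇒≥ (λ lt → none (tabulate Y ,
              ( (λ v h → trans (lookup∘tabulate Y v) (A⊑Y v h))
              , (λ v h → trans (lookup∘tabulate Y v) (B∩Y v h)) )
              , subst (_< cut X) (cut-cong (λ v → sym (lookup∘tabulate Y v))) lt))
      ... | yes (S , sepS , lt) = again fuel le
        where
        again : ∀ fuel → cut X ≤ fuel → _
        again zero       le = contradiction (≤-trans lt le) λ ()
        again (suc fuel) le = descend fuel (lookup S) (s≤s⁻¹ (≤-trans lt le)) sepS

    minimum-cut : Σ[ X ∈ VSet ] Separates X × (∀ Y → Separates Y → cut X ≤ cut Y)
    minimum-cut = descend (cut A) A ≤-refl
      ((λ _ → id) , λ v Bv → ¬-not (λ Av → true≢false (trans (sym Bv) (A∩B v Av))))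

-- The core, havens, and the induction on the family.

module Haven (G : Graph) (k : ℕ) where
  open GraphProperties G
  open Menger G using (menger)
  open Splits G k
  open Duality G k

  -- The robber answers the cops' move to F with any vertex of big F in core.
  record Haven : Set where
    field
      core      : VSet
      core-con  : ∀ {u v} → core u ≡ true → core v ≡ true → ThreeEdgeConnected u v
      big       : Subset size → VSet
      connected : ∀ F {x y} → big F x ≡ true → big F y ≡ true → Route (_∉ˢ F) x y
      large     : ∀ F → ∣ F ∣ ≤ k → k < # (λ v → big F v ∧ core v)
      meet      : ∀ F F′ → ∣ F ∣ ≤ k → ∣ F′ ∣ ≤ k → ∃[ v ] big F v ≡ true × big F′ v ≡ true

  Disj : VSet → VSet → Set
  Disj X Y = ∀ v → X v ≡ true → Y v ≡ false

  module _ (ℬ : Family) (up : UpClosed ℬ) (inh : Inhabited ℬ) (meets : Intersecting ℬ)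
           (oriented : ∀ X → cut X ≤ 2 → X ∉ᶠ ℬ → ∁ X ∈ᶠ ℬ) where

    Light : VSet → Set
    Light X = cut X ≤ 2 × X ∉ᶠ ℬ

    core? : ∀ v → Dec (Any (λ S → cut (lookup S) ≤ 2 × lookup S v ≡ false) ℬ)
    core? v = Any.any? (λ S → (cut (lookup S) ≤? 2) ×-dec (lookup S v ≟ᵇ false)) ℬ

    core : VSet
    core v = not (does (core? v))

    core-thin : ∀ {v X} → core v ≡ true → cut X ≤ 2 → X ∈ᶠ ℬ → X v ≡ true
    core-thin {v} {X} cv thin X∈ = ¬-not (λ Xv →
      from-¬does (core? v) (not-injective {does (core? v)} {false} cv)
        (lose X∈ ( ≤-trans (≤-reflexive (cut-cong (lookup∘tabulate X))) thin
                 , trans (lookup∘tabulate X v) Xv)))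

    -- Of a thin set separating `u` from `v` and its complement, one is in `ℬ` by `oriented`, and it
    -- would have to contain both vertices of the core.
    core-con : ∀ {u v} → core u ≡ true → core v ≡ true → ThreeEdgeConnected u v
    core-con {u} {v} cu cv with menger u v
    ... | inj₁ con = con
    ... | inj₂ (X , Xu , Xv , thin) with X ∈ᶠ? ℬ
    ...   | yes X∈ = contradiction (trans (sym (core-thin {X = X} cv thin X∈)) Xv) true≢false
    ...   | no X∉  = contradiction
              (trans (sym (core-thin {X = ∁ X} cu (subst (_≤ 2) (sym (cut-∁ X)) thin) (oriented X thin X∉)))
                     (cong not Xu)) true≢false

    -- Some thin member of `ℬ` misses `v`. Its complement is disjoint from it and therefore not in
    -- `ℬ`.
    outside-core : ∀ v → core v ≡ false → Σ[ X ∈ VSet ] Light X × X v ≡ true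
    outside-core v cv with find (from-does (core? v) (not-injective {does (core? v)} {true} cv))
    ... | S , S∈ , thin , v∉ = ∁ (lookup S)
        , ( subst (_≤ 2) (sym (cut-∁ (lookup S))) thin
          , λ ∁S∈ → case meets (∈ᶠ-lookup S∈) ∁S∈ of λ (w , p , q) →
              true≢false (trans (sym q) (cong not p)))
        , cong not v∉

    light-⊑ : ∀ {X Y} → X ⊑ Y → Y ∉ᶠ ℬ → X ∉ᶠ ℬ
    light-⊑ X⊑Y Y∉ X∈ = Y∉ (up X∈ X⊑Y)

    -- By posimodularity one of X ∖ Y and Y ∖ X is again thin.
    insert : VSet → List VSet → List VSet
    insert X [] = X ∷ []
    insert X (Y ∷ Ys) with cut (X ∖ Y) ≤? 2
    ... | yes _ = Y ∷ insert (X ∖ Y) Ys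
    ... | no _  = (Y ∖ X) ∷ insert X Ys

    insert-light : ∀ {X} Ys → Light X → All Light Ys → All Light (insert X Ys)
    insert-light [] lX [] = lX ∷ []
    insert-light {X} (Y ∷ Ys) (tX , X∉) ((tY , Y∉) ∷ lYs) with cut (X ∖ Y) ≤? 2
    ... | yes t = (tY , Y∉) ∷ insert-light Ys (t , light-⊑ (∖-⊑ X Y) X∉) lYs
    ... | no ¬t = (thin , light-⊑ (∖-⊑ Y X) Y∉) ∷ insert-light Ys (tX , X∉) lYs
      where
      thin : cut (Y ∖ X) ≤ 2
      -- The two cuts add up to at most 4, and that of `X ∖ Y` exceeds 2.
      thin = +-cancelˡ-≤ 2 _ _ (≤-trans (+-monoˡ-≤ _ (<⇒≤ (≰⇒> ¬t)))
               (≤-trans (cut-posimodular X Y) (+-mono-≤ tX tY)))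

    insert-apart : ∀ {D X} Ys → Disj D X → All (Disj D) Ys → All (Disj D) (insert X Ys)
    insert-apart [] dX [] = dX ∷ []
    insert-apart {X = X} (Y ∷ Ys) dX (dY ∷ dYs) with cut (X ∖ Y) ≤? 2
    ... | yes _ = dY ∷ insert-apart Ys (λ v → ⊑-∉ (∖-⊑ X Y) v ∘ dX v) dYs
    ... | no _  = (λ v → ⊑-∉ (∖-⊑ Y X) v ∘ dY v) ∷ insert-apart Ys dX dYs

    insert-disjoint : ∀ {X} Ys → AllPairs Disj Ys → AllPairs Disj (insert X Ys)
    insert-disjoint [] [] = [] ∷ []
    insert-disjoint {X} (Y ∷ Ys) (dY ∷ dYs) with cut (X ∖ Y) ≤? 2
    ... | yes _ = insert-apart Ys (λ v Yv → ¬-not (λ h → true≢false (trans (sym Yv) (∖-∉ X Y v h)))) dY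
                  ∷ insert-disjoint Ys dYs
    ... | no _  = insert-apart Ys (∖-∉ Y X) (All.map (λ d v → d v ∘ ∖-⊑ Y X v) dY) ∷ insert-disjoint Ys dYs

    insert-covers : ∀ {X} Ys v → X v ≡ true ⊎ Any (λ Y → Y v ≡ true) Ys →
                    Any (λ Y → Y v ≡ true) (insert X Ys)
    insert-covers [] v (inj₁ Xv) = here Xv
    insert-covers {X} (Y ∷ Ys) v c with cut (X ∖ Y) ≤? 2 | X v in Xv | Y v in Yv
    ... | yes _ | _     | true  = here Yv
    ... | no _  | false | true  = here (∈-∖ Y X v Yv Xv)
    ... | no _  | true  | _     = there (insert-covers Ys v (inj₁ Xv))
    ... | yes _ | true  | false = there (insert-covers Ys v (inj₁ (∈-∖ X Y v Xv Yv)))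
    ... | yes _ | false | false with c
    ...   | inj₂ (here p)  = contradiction (trans (sym p) Yv) true≢false
    ...   | inj₂ (there p) = there (insert-covers Ys v (inj₂ p))
    insert-covers {X} (Y ∷ Ys) v c | no _ | false | false with c
    ...   | inj₂ (here p)  = contradiction (trans (sym p) Yv) true≢false
    ...   | inj₂ (there p) = there (insert-covers Ys v (inj₂ p))

    record Fringe (vs : List Vertex) : Set where
      field
        sets     : List VSet
        light    : All Light sets
        disjoint : AllPairs Disj sets
        covers   : ∀ v → v ∈ vs → core v ≡ false → Any (λ Y → Y v ≡ true) sets

    fringe : ∀ vs → Fringe vs
    fringe [] = record { sets = [] ; light = [] ; disjoint = [] ; covers = λ _ () }
    fringe (u ∷ vs) = extend (core u) refl
      where
      open Fringe (fringe vs)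
      extend : ∀ b → core u ≡ b → Fringe (u ∷ vs)
      extend true cu = record { sets = sets ; light = light ; disjoint = disjoint
        ; covers = λ { v (here refl) cv → contradiction (trans (sym cu) cv) true≢false
                     ; v (there v∈) cv → covers v v∈ cv } }
      extend false cu with outside-core u cu
      ... | X , lX , Xu = record
        { sets = insert X sets ; light = insert-light sets lX light ; disjoint = insert-disjoint sets disjoint
        ; covers = λ { v (here refl) cv → insert-covers sets v (inj₁ Xu)
                     ; v (there v∈) cv → insert-covers sets v (inj₂ (covers v v∈ cv)) } }

    module _ (F : Subset size) where

      component : Vertex → VSet
      component x y = does (route? F x y)

      -- As members of `ℬ` intersect, at most one component of G - F qualifies; the set is that
      -- component, or empty if there is none.
      big : VSet
      big x = does (component x ∈ᶠ? ℬ)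

      component-cong : ∀ {x y} → Route (_∉ˢ F) x y → component x ≗ component y
      component-cong {x} {y} r z with route? F x z | route? F y z
      ... | yes _ | yes _ = refl
      ... | no _  | no _  = refl
      ... | yes p | no ¬q = contradiction (chain-++ (route-sym r) p) ¬q
      ... | no ¬p | yes q = contradiction (chain-++ r q) ¬p

      big-component : ∀ {x} → big x ≡ true → component x ∈ᶠ ℬ
      big-component {x} = from-does (component x ∈ᶠ? ℬ)

      big-cong : ∀ {x y} → Route (_∉ˢ F) x y → big x ≡ true → big y ≡ true
      big-cong {x} {y} r bx = dec-true (component y ∈ᶠ? ℬ) (∈ᶠ-cong (component-cong r) (big-component bx))

      big-connected : ∀ {x y} → big x ≡ true → big y ≡ true → Route (_∉ˢ F) x y
      big-connected {x} {y} bx by with meets (big-component bx) (big-component by)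
      ... | z , p , q = chain-++ (from-does (route? F x z) p) (route-sym (from-does (route? F y z) q))

      representative : Vertex → Maybe Vertex
      representative x = first (component x)

      representative-route : ∀ {x y} → representative x ≡ representative y → Route (_∉ˢ F) x y
      representative-route {x} {y} eq with first-just (component x) x (dec-true (route? F x x) ε)
      ... | z , p , xz = chain-++ (from-does (route? F x z) xz)
              (route-sym (from-does (route? F y z) (first-sound (component y) (trans (sym eq) p))))

    -- A node under construction: `As` are the thin sets still to be carved off, and `vs` bounds the
    -- bag that remains in the end. By `apart`, these sets meet no uncounted branch, so carving
    -- leaves the cuts of such branches unchanged.
    record State (vs : VSet) (As : List VSet) : Set₁ where
      field
        split : Split
      open Split split public
      field
        outer       : Label
        outer≢bag   : outer ≢ bag
        outer-empty : ∀ v → colour v ≢ outer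
        light-parts : ∀ l → l ≢ bag → part l ∉ᶠ ℬ
        in-bag      : ∀ v → colour v ≡ bag → vs v ≡ true ⊎ Any (λ A → A v ≡ true) As
        apart       : All (λ A → ∀ v → A v ≡ true → counted (colour v) ≡ false → colour v ≡ bag) As

    finish : ∀ {vs} → # vs ≤ k → State vs [] → Sol ℬ everything
    finish {vs} le st = node split outer (≤-trans (#-mono small) le) outer≢bag
        (λ v → cong not (sym (not-in-part (outer-empty v))))
        (λ l l≢bag _ → leaf (light-parts l l≢bag) (part-cut l l≢bag))
      where
      open State st
      small : part bag ⊑ vs
      small v h with in-bag v (part-colour h)
      ... | inj₁ p = p

    -- The thin set A is carved off as a new branch.  If A minus the counted branches
    -- is still thin, only that is carved off, and no counted edge changes; otherwise
    -- it has a larger cut than A, and carving off all of A loses counted edges.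
    carve : ∀ {vs A As} → Light A → All (Disj A) As → State vs (A ∷ As) → State vs As
    carve {vs} {A} {As} (thinA , A∉) disj st = decide (cut (A ∖ Z) ≤? 2)
      where
      open State st
      Z : VSet
      Z v = counted (colour v)

      infix 4 _≟ᵐ_
      _≟ᵐ_ : (l m : Maybe Label) → Dec (l ≡ m)
      _≟ᵐ_ = ≡ᵐ-dec _≟ˡ_

      -- The label `nothing` is for the new branch, which is uncounted and still empty.
      fresh : Split
      fresh = record
        { Label = Maybe Label ; _≟ˡ_ = _≟ᵐ_ ; labels = nothing ∷ map just labels
        ; complete = λ { nothing → here refl ; (just l) → there (∈-map⁺ just (complete l)) }
        ; bag = just bag ; colour = just ∘ colour ; counted = countedᵐ ; uncounted-bag = uncounted-bag
        ; few = few ; thin = thinᵐ }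
        where
        countedᵐ : Maybe Label → Bool
        countedᵐ nothing  = false
        countedᵐ (just l) = counted l
        thinᵐ : ∀ l → l ≢ just bag → countedᵐ l ≡ false → cut (λ v → does (just (colour v) ≟ᵐ l)) ≤ 2
        thinᵐ nothing  _     _  = ≤-trans (≤-reflexive (cut-empty (λ v → refl))) z≤n
        thinᵐ (just l) l≢bag cl = thin l (l≢bag ∘ cong just) cl

      carved : ∀ X → X ⊑ A → cut X ≤ 2 → cut X ≤ cut (X ∖ Z) →
               (∀ v → A v ≡ true → X v ≡ false → Z v ≡ true) → State vs As
      carved X X⊑A thinX tight rest = record
        { split = recolour (λ ()) (λ _ → tight) thin′
        ; outer = just outer ; outer≢bag = outer≢bag ∘ just-injective
        ; outer-empty = λ v h → outer-empty v (just-injective (old-colour v (λ ()) h))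
        ; light-parts = light-parts′ ; in-bag = in-bag′ ; apart = All.zipWith apart′ (disj , tail apart) }
        where
        open Recolour fresh X nothing
        tail : ∀ {P : VSet → Set} {B Bs} → All P (B ∷ Bs) → All P Bs
        tail (_ ∷ ps) = ps
        old-colour : ∀ v {l} → l ≢ nothing → colour′ v ≡ l → just (colour v) ≡ l
        old-colour v l≢ h with X v
        ... | true  = contradiction (sym h) l≢
        ... | false = h
        kept : ∀ v {l} → colour′ v ≡ just l → X v ≡ false
        kept v h with X v
        ... | false = refl
        part-fresh : part′ nothing ≗ X
        part-fresh v with X v
        ... | true  = refl
        ... | false = refl
        thin′ : ∀ l → l ≢ just bag → Split.counted fresh l ≡ false → cut (part′ l) ≤ 2
        thin′ nothing  _     _  = ≤-trans (≤-reflexive (cut-cong part-fresh)) thinX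
        thin′ (just l) l≢bag cl = ≤-trans (≤-reflexive (cut-cong same)) (Split.thin fresh (just l) l≢bag cl)
          where
          -- An uncounted branch does not meet `A`, so carving removes nothing from it.
          X∩l : ∀ v → X v ≡ true → just (colour v) ≢ just l
          X∩l v Xv refl with apart
          ... | apartA ∷ _ = l≢bag (cong just (apartA v (X⊑A v Xv) cl))
          same : part′ (just l) ≗ Split.part fresh (just l)
          same v with X v in Xv
          ... | true  = sym (dec-false (just (colour v) ≟ᵐ just l) (X∩l v Xv))
          ... | false = refl
        light-parts′ : ∀ l → l ≢ just bag → part′ l ∉ᶠ ℬ
        light-parts′ nothing  _     = light-⊑ (λ v h → X⊑A v (trans (sym (part-fresh v)) h)) A∉
        light-parts′ (just l) l≢bag = light-⊑ (λ v h → in-part (just-injective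
          (old-colour v (λ ()) (from-does (colour′ v ≟ᵐ just l) h)))) (light-parts l (l≢bag ∘ cong just))
        in-bag′ : ∀ v → colour′ v ≡ just bag → vs v ≡ true ⊎ Any (λ B → B v ≡ true) As
        in-bag′ v h with just-injective (old-colour v (λ ()) h)
        ... | eq with in-bag v eq
        ...   | inj₁ p          = inj₁ p
        ...   | inj₂ (there p)  = inj₂ p
        -- A vertex of `A` that is not carved off has a counted label, and the label of the bag is
        -- uncounted.
        ...   | inj₂ (here Av)  = contradiction
                  (trans (sym (rest v Av (kept v h))) (trans (cong counted eq) uncounted-bag)) true≢false
        apart′ : ∀ {B} → Disj A B × (∀ v → B v ≡ true → counted (colour v) ≡ false → colour v ≡ bag) →
                 ∀ v → B v ≡ true → Split.counted fresh (colour′ v) ≡ false → colour′ v ≡ just bag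
        apart′ (A∩B , apartB) v Bv cv with X v in Xv
        ... | true  = contradiction (trans (sym Bv) (A∩B v (X⊑A v Xv))) true≢false
        ... | false = cong just (apartB v Bv cv)

      decide : Dec (cut (A ∖ Z) ≤ 2) → State vs As
      decide (yes t) = carved (A ∖ Z) (∖-⊑ A Z) t
        (≤-reflexive (cut-cong (λ v → sym (idem (A v) (Z v)))))
        (λ v Av h → not-injective {Z v} {true} (trans (sym (cong (_∧ not (Z v)) Av)) h))
        where
        idem : ∀ a b → (a ∧ not b) ∧ not b ≡ a ∧ not b
        idem true  true  = refl
        idem true  false = refl
        idem false b     = refl
      decide (no ¬t) = carved A (λ _ → id) thinA (≤-trans thinA (<⇒≤ (≰⇒> ¬t)))
        (λ v Av h → contradiction (trans (sym Av) h) true≢false)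

    carve-all : ∀ {vs} As → All Light As → AllPairs Disj As → State vs As → State vs []
    carve-all []       []       []       st = st
    carve-all (A ∷ As) (l ∷ ls) (d ∷ ds) st = carve-all As ls ds (carve l d st)

    -- The bag is the component of G - F in ℬ.  It may be too large; carving off thin
    -- sets leaves only its intersection with the core.
    components : ∀ F → ∣ F ∣ ≤ k → ∀ As → (∀ v → core v ≡ false → Any (λ A → A v ≡ true) As) →
                 State (λ v → big F v ∧ core v) As
    components F F≤k As covers = record
      { split = split ; outer = just nothing ; outer≢bag = λ () ; outer-empty = not-outer
      ; light-parts = light-parts ; in-bag = in-bag ; apart = All.universal (λ _ v _ → uncounted v) As }
      where
      Label : Set
      -- `nothing` is the bag, `just nothing` the empty outer branch, and `just (just m)` the
      -- component with representative `m`.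
      Label = Maybe (Maybe (Maybe Vertex))
      everyLabel : List Label
      everyLabel = nothing ∷ map just (nothing ∷ map just (nothing ∷ map just (allFin order)))
      complete : ∀ l → l ∈ everyLabel
      complete nothing = here refl
      complete (just nothing) = there (∈-map⁺ just (here refl))
      complete (just (just nothing)) = there (∈-map⁺ just (there (∈-map⁺ just (here refl))))
      complete (just (just (just v))) =
        there (∈-map⁺ just (there (∈-map⁺ just (there (∈-map⁺ just (∈-allFin v))))))
      infix 4 _≟ˡ_
      _≟ˡ_ : (l m : Label) → Dec (l ≡ m)
      _≟ˡ_ = ≡ᵐ-dec (≡ᵐ-dec (≡ᵐ-dec _≟_))
      colour : Vertex → Label
      colour v = if big F v then nothing else just (just (representative F v))
      counted : Label → Bool
      counted nothing         = false
      counted (just nothing)  = false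
      counted (just (just _)) = true
      part : Label → VSet
      part l v = does (colour v ≟ˡ l)
      not-outer : ∀ v → colour v ≢ just nothing
      not-outer v h with big F v
      not-outer v () | true
      not-outer v () | false
      uncounted : ∀ v → counted (colour v) ≡ false → colour v ≡ nothing
      uncounted v h with big F v
      ... | true = refl
      same-colour : ∀ {x y} → Route (_∉ˢ F) x y → colour x ≡ colour y
      same-colour {x} {y} r with big F x in bx | big F y in by
      ... | true  | true  = refl
      ... | false | false = cong (just ∘ just) (first-cong (component-cong F r))
      ... | true  | false = contradiction (trans (sym (big-cong F r bx)) by) true≢false
      ... | false | true  = contradiction (trans (sym (big-cong F (route-sym r) by)) bx) true≢false
      counts : Edge → Bool
      counts e = not (does (colour (src e) ≟ˡ colour (tgt e))) ∧ (counted (colour (src e)) ∨ counted (colour (tgt e)))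
      -- An edge outside `F` has both ends in one component, hence of one colour, and is not
      -- counted.
      counts-F : counts ⊑ lookup F
      counts-F e h with e ∈ˢ? F
      ... | yes e∈ = []=⇒lookup e∈
      ... | no e∉  = contradiction
            (trans (sym (∧-leftᵗ h)) (cong not (dec-true (colour (src e) ≟ˡ colour (tgt e))
              (same-colour ((e , joins-ends e , e∉) ◂ ε))))) true≢false
      split : Split
      split = record
        { Label = Label ; _≟ˡ_ = _≟ˡ_ ; labels = everyLabel ; complete = complete ; bag = nothing
        ; colour = colour ; counted = counted ; uncounted-bag = refl
        ; few = ≤-trans (#-mono counts-F) (≤-trans (≤-reflexive (∣lookup∣ F)) F≤k)
        ; thin = λ { nothing ne _ → contradiction refl ne
                   ; (just nothing) _ _ → ≤-trans (≤-reflexive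
                       (cut-empty (λ v → dec-false (colour v ≟ˡ just nothing) (not-outer v)))) z≤n } }
      colour-big : ∀ {v m} → colour v ≡ just (just m) → big F v ≡ false × representative F v ≡ m
      colour-big {v} h with big F v
      colour-big {v} refl | false = refl , refl
      light-parts : ∀ l → l ≢ nothing → part l ∉ᶠ ℬ
      light-parts nothing ne _ = ne refl
      light-parts (just nothing) _ l∈ with inh l∈
      ... | v , h = not-outer v (from-does (colour v ≟ˡ just nothing) h)
      light-parts (just (just m)) _ l∈ with inh l∈
      ... | x , h with colour-big (from-does (colour x ≟ˡ just (just m)) h)
      ...   | ¬bx , refl = from-¬does (component F x ∈ᶠ? ℬ) ¬bx (up l∈ inside-component)
        where
        inside-component : part (just (just (representative F x))) ⊑ component F x
        inside-component y h′ with colour-big (from-does (colour y ≟ˡ just (just (representative F x))) h′)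
        ... | _ , eq = dec-true (route? F x y) (representative-route F (sym eq))
      in-bag : ∀ v → colour v ≡ nothing → (big F v ∧ core v) ≡ true ⊎ Any (λ A → A v ≡ true) As
      in-bag v h with big F v | core v in cv
      ... | true | true  = inj₁ refl
      ... | true | false = inj₂ (covers v cv)

    few-in-core : ∀ F → ∣ F ∣ ≤ k → # (λ v → big F v ∧ core v) ≤ k → Sol ℬ everything
    few-in-core F F≤k le = finish le (carve-all sets light disjoint
        (components F F≤k sets (λ v → covers v (∈-allFin v))))
      where open Fringe (fringe (allFin order))

    haven-or-sol : Sol ℬ everything ⊎ Haven
    haven-or-sol with anySubset? (λ F → (∣ F ∣ ≤? k) ×-dec (# (λ v → big F v ∧ core v) ≤? k))
    ... | yes (F , F≤k , le) = inj₁ (few-in-core F F≤k le)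
    ... | no none = inj₂ record
        { core = core ; core-con = core-con ; big = big ; connected = big-connected
        ; large = large ; meet = meet }
      where
      large : ∀ F → ∣ F ∣ ≤ k → k < # (λ v → big F v ∧ core v)
      large F F≤k = ≰⇒> (λ le → none (F , F≤k , le))
      some : ∀ F → ∣ F ∣ ≤ k → ∃[ x ] big F x ≡ true
      some F F≤k with #-witness (≤-trans (s≤s z≤n) (large F F≤k))
      ... | x , h = x , ∧-leftᵗ h
      meet : ∀ F F′ → ∣ F ∣ ≤ k → ∣ F′ ∣ ≤ k → ∃[ v ] big F v ≡ true × big F′ v ≡ true
      meet F F′ F≤k F′≤k with some F F≤k | some F′ F′≤k
      ... | x , bx | y , by with meets (big-component F bx) (big-component F′ by)
      ...   | z , xz , yz = z , big-cong F (from-does (route? F x z) xz) bx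
                              , big-cong F′ (from-does (route? F′ y z) yz) by

  -- Upward closure could fail only at `A` itself, but a member of `ℬ` contained in `A` equals `A`
  -- by minimality.
  remove-up : ∀ {ℬ A} → UpClosed ℬ → Minimal ℬ A → UpClosed (ℬ ∖ᶠ A)
  remove-up {ℬ} {A} up min {X} {Y} X∈ X⊑Y with ∈-filter⁻ (λ S → ¬? (≡ˢ-dec _≟ᵇ_ S (tabulate A))) {xs = ℬ} X∈
  ... | X∈ℬ , X≢A = ∈-∖ᶠ (up X∈ℬ X⊑Y) λ eq → X≢A (tabulate-cong (λ v →
          ⊑-antisym (λ w h → trans (sym (tabulate-injective eq w)) (X⊑Y w h))
                    (min X∈ℬ (λ w h → trans (sym (tabulate-injective eq w)) (X⊑Y w h))) v))

  remove-inhabited : ∀ {ℬ A} → Inhabited ℬ → Inhabited (ℬ ∖ᶠ A)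
  remove-inhabited {ℬ} {A} inh X∈ = inh (proj₁ (∈-filter⁻ (λ S → ¬? (≡ˢ-dec _≟ᵇ_ S (tabulate A))) {xs = ℬ} X∈))

  remove-shorter : ∀ {ℬ A} → A ∈ᶠ ℬ → length (ℬ ∖ᶠ A) < length ℬ
  remove-shorter {ℬ} {A} A∈ = filter-notAll (λ S → ¬? (≡ˢ-dec _≟ᵇ_ S (tabulate A))) ℬ
    (lose A∈ (λ ne → ne refl))

  solve : ∀ fuel ℬ → length ℬ < fuel → UpClosed ℬ → Inhabited ℬ → Sol ℬ everything ⊎ Haven
  solve (suc fuel) ℬ len up inh with Any.any? (λ S → Any.any? (disjoint? S) ℬ) ℬ
    where
    disjoint? : ∀ S T → Dec (∀ v → lookup S v ≡ true → lookup T v ≡ false)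
    disjoint? S T = all? (λ v → (lookup S v ≟ᵇ true) →-dec (lookup T v ≟ᵇ false))
  ... | yes some = uncurry (λ S (S∈ , some′) → uncurry (λ T (T∈ , disj) →
          from-disjoint (lookup S) (lookup T) (∈ᶠ-lookup S∈) (∈ᶠ-lookup T∈) disj) (find some′)) (find some)
    where
    from-minimal : ∀ A B → A ∈ᶠ ℬ → B ∈ᶠ ℬ → Minimal ℬ A → Minimal ℬ B → Disj A B →
                   Sol ℬ everything ⊎ Haven
    from-minimal A B A∈ B∈ minA minB A∩B
      with solve fuel (ℬ ∖ᶠ A) (s≤s⁻¹ (≤-trans (s≤s (remove-shorter A∈)) len)) (remove-up up minA) (remove-inhabited inh)
         | solve fuel (ℬ ∖ᶠ B) (s≤s⁻¹ (≤-trans (s≤s (remove-shorter B∈)) len)) (remove-up up minB) (remove-inhabited inh)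
         | inh A∈ | inh B∈
    ... | inj₂ haven | _ | _ | _ = inj₂ haven
    ... | inj₁ _ | inj₂ haven | _ | _ = inj₂ haven
    ... | inj₁ solA | inj₁ solB | a , Aa | b , Bb with reroot Aa solA | reroot Bb solB
    ...   | inj₁ sol | _ = inj₁ sol
    ...   | inj₂ _ | inj₁ sol = inj₁ sol
    ...   | inj₂ (_ , outsideA) | inj₂ (_ , outsideB) with minimum-cut A B A∩B
    ...     | X , (A⊑X , B∩X) , least = inj₁ (glue solX sol∁X)
      where
      -- Nothing lies outside the whole vertex set, so an empty leaf completes the re-rooting.
      nowhere : Sol ℬ (∁ everything)
      nowhere = leaf (λ h → case inh h of λ ()) (inj₁ (≤-trans (≤-reflexive (cut-empty (λ _ → refl))) z≤n))
      -- The piece covering the complement of `B` is shrunk by the complement of `X`, which leaves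
      -- `X`. Taking complements turns the minimality of `X` into the tightness that `push`
      -- requires.
      solX : Sol ℬ X
      solX = sol-resp eq (push up B (∁ X) (λ v h → cong not (B∩X v h)) tight (λ v h → cong not h) (outsideB nowhere))
        where
        tight : ∀ Y → B ⊑ Y → Y ⊑ ∁ X → cut (∁ X) ≤ cut Y
        tight Y B⊑Y Y⊑∁X = ≤-trans (≤-reflexive (cut-∁ X)) (≤-trans (least (∁ Y)
          ( (λ v h → cong not (⊑-∉ Y⊑∁X v (cong not (A⊑X v h))))
          , (λ v h → cong not (B⊑Y v h)))) (≤-reflexive (cut-∁ Y)))
        eq : ∁ B ∖ ∁ X ≗ X
        eq v with X v | B v | B∩X v
        ... | true  | true  | h = contradiction (h refl) λ ()
        ... | true  | false | _ = refl
        ... | false | true  | _ = refl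
        ... | false | false | _ = refl
      sol∁X : Sol ℬ (∁ X)
      sol∁X = sol-resp eq (push up A X A⊑X tight (λ v h → cong not h) (outsideA nowhere))
        where
        tight : ∀ Y → A ⊑ Y → Y ⊑ X → cut X ≤ cut Y
        tight Y A⊑Y Y⊑X = least Y (A⊑Y , λ v h → ⊑-∉ Y⊑X v (B∩X v h))
        eq : ∁ A ∖ X ≗ ∁ X
        eq v with X v | A v | A⊑X v
        ... | true  | true  | _ = refl
        ... | true  | false | _ = refl
        ... | false | true  | h = contradiction (h refl) λ ()
        ... | false | false | _ = refl

    from-disjoint : ∀ S T → S ∈ᶠ ℬ → T ∈ᶠ ℬ → Disj S T → Sol ℬ everything ⊎ Haven
    from-disjoint S T S∈ T∈ disj with shrink (# S) S ≤-refl S∈ | shrink (# T) T ≤-refl T∈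
    ... | A , A⊑S , A∈ , minA | B , B⊑T , B∈ , minB =
      from-minimal A B A∈ B∈ minA minB (λ v h → ⊑-∉ B⊑T v (disj v (A⊑S v h)))
  ... | no none with anySubset? (λ S → (cut (lookup S) ≤? 2) ×-dec ¬? (lookup S ∈ᶠ? ℬ) ×-dec ¬? (∁ (lookup S) ∈ᶠ? ℬ))
  ...   | yes (S , thin , S∉ , ∁S∉) = inj₁ (glue (leaf S∉ (inj₁ thin))
            (leaf ∁S∉ (inj₁ (≤-trans (≤-reflexive (cut-∁ (lookup S))) thin))))
  ...   | no balanced = haven-or-sol ℬ up inh meets oriented
    where
    meets : Intersecting ℬ
    meets {X} {Y} X∈ Y∈ with any? (λ v → (X v ≟ᵇ true) ×-dec (Y v ≟ᵇ true))
    ... | yes found = found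
    ... | no apart  = contradiction (lose X∈ (lose Y∈ (λ v h →
            trans (lookup∘tabulate Y v) (¬-not (λ Yv → apart (v , trans (sym (lookup∘tabulate X v)) h , Yv)))))) none
    oriented : ∀ X → cut X ≤ 2 → X ∉ᶠ ℬ → ∁ X ∈ᶠ ℬ
    oriented X thin X∉ = decidable-stable (∁ X ∈ᶠ? ℬ) (λ ∁X∉ → balanced (tabulate X ,
      ≤-trans (≤-reflexive (cut-cong (lookup∘tabulate X))) thin ,
      X∉ ∘ ∈ᶠ-cong (lookup∘tabulate X) ,
      ∁X∉ ∘ ∈ᶠ-cong (cong not ∘ lookup∘tabulate X)))

  nonempty? : (S : Subset order) → Dec (∃[ v ] lookup S v ≡ true)
  nonempty? S = any? (λ v → lookup S v ≟ᵇ true)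

  nonempty : Family
  nonempty = filter nonempty? (subsets order)

  nonempty-∈ : ∀ {X v} → X v ≡ true → X ∈ᶠ nonempty
  nonempty-∈ {X} {v} Xv = ∈-filter⁺ nonempty? (∈-subsets (tabulate X)) (v , trans (lookup∘tabulate X v) Xv)

  nonempty-inhabited : Inhabited nonempty
  nonempty-inhabited {X} X∈ with ∈-filter⁻ nonempty? {xs = subsets order} X∈
  ... | _ , v , h = v , trans (sym (lookup∘tabulate X v)) h

  -- For this family every leaf is an empty set, so a solution is a genuine decomposition.
  duality : Sol nonempty everything ⊎ Haven
  duality = solve (suc (length nonempty)) nonempty ≤-refl
    (λ X∈ X⊑Y → case nonempty-inhabited X∈ of λ (v , h) → nonempty-∈ (X⊑Y v h))
    nonempty-inhabited

-- Rooted trees and their graphs.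

module RootedTrees where

  -- join s t attaches the root of t to the root of s, by the edge inj₁ tt.
  data Tree : Set where
    single : Tree
    join   : Tree → Tree → Tree

  Node TEdge : Tree → Set
  Node single     = ⊤
  Node (join s t) = Node s ⊎ Node t
  TEdge single     = ⊥
  TEdge (join s t) = ⊤ ⊎ (TEdge s ⊎ TEdge t)

  root : ∀ t → Node t
  root single     = tt
  root (join s t) = inj₁ (root s)

  upper lower : ∀ {t} → TEdge t → Node t
  upper {join s t} (inj₁ tt)       = inj₁ (root s)
  upper {join s t} (inj₂ (inj₁ e)) = inj₁ (upper e)
  upper {join s t} (inj₂ (inj₂ e)) = inj₂ (upper e)
  lower {join s t} (inj₁ tt)       = inj₂ (root t)
  lower {join s t} (inj₂ (inj₁ e)) = inj₁ (lower e)
  lower {join s t} (inj₂ (inj₂ e)) = inj₂ (lower e)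

  -- The component of the tree minus the edge that avoids the root, found by recursion;
  -- `reachable⇒side` and `side⇒reachable` relate it to paths.
  below : ∀ {t} → TEdge t → Node t → Bool
  below {join s t} (inj₁ tt)       (inj₁ x) = false
  below {join s t} (inj₁ tt)       (inj₂ y) = true
  below {join s t} (inj₂ (inj₁ e)) (inj₁ x) = below e x
  below {join s t} (inj₂ (inj₁ e)) (inj₂ y) = false
  below {join s t} (inj₂ (inj₂ e)) (inj₁ x) = false
  below {join s t} (inj₂ (inj₂ e)) (inj₂ y) = below e y

  below-root : ∀ {t} (e : TEdge t) → below e (root t) ≡ false
  below-root {join s t} (inj₁ tt)       = refl
  below-root {join s t} (inj₂ (inj₁ e)) = below-root e
  below-root {join s t} (inj₂ (inj₂ e)) = refl

  below-upper : ∀ {t} (e : TEdge t) → below e (upper e) ≡ false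
  below-upper {join s t} (inj₁ tt)       = refl
  below-upper {join s t} (inj₂ (inj₁ e)) = below-upper e
  below-upper {join s t} (inj₂ (inj₂ e)) = below-upper e

  below-lower : ∀ {t} (e : TEdge t) → below e (lower e) ≡ true
  below-lower {join s t} (inj₁ tt)       = refl
  below-lower {join s t} (inj₂ (inj₁ e)) = below-lower e
  below-lower {join s t} (inj₂ (inj₂ e)) = below-lower e

  -- The source of acyclicity: through `cross-side`, a walk that changes sides of `e` has to use
  -- `e`.
  below-other : ∀ {t} {e d : TEdge t} → e ≢ d → below e (upper d) ≡ below e (lower d)
  below-other {join s t} {inj₁ tt} {inj₁ tt} ne = contradiction refl ne
  below-other {join s t} {inj₁ tt} {inj₂ (inj₁ d)} ne = refl
  below-other {join s t} {inj₁ tt} {inj₂ (inj₂ d)} ne = refl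
  below-other {join s t} {inj₂ (inj₁ e)} {inj₁ tt} ne = below-root e
  below-other {join s t} {inj₂ (inj₁ e)} {inj₂ (inj₁ d)} ne = below-other (ne ∘ cong (inj₂ ∘ inj₁))
  below-other {join s t} {inj₂ (inj₁ e)} {inj₂ (inj₂ d)} ne = refl
  below-other {join s t} {inj₂ (inj₂ e)} {inj₁ tt} ne = sym (below-root e)
  below-other {join s t} {inj₂ (inj₂ e)} {inj₂ (inj₁ d)} ne = refl
  below-other {join s t} {inj₂ (inj₂ e)} {inj₂ (inj₂ d)} ne = below-other (ne ∘ cong (inj₂ ∘ inj₂))

  -- Connection as a generated equivalence relation, which transfers easily through `join`; walks
  -- are produced only at the end, by `link→route`.
  data Link {t : Tree} (Q : TEdge t → Set) : Node t → Node t → Set where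
    here   : ∀ {x} → Link Q x x
    edge   : ∀ {e} → Q e → Link Q (upper e) (lower e)
    flip   : ∀ {x y} → Link Q x y → Link Q y x
    _then_ : ∀ {x y z} → Link Q x y → Link Q y z → Link Q x z

  link-left : ∀ {s t Q} {Q′ : TEdge (join s t) → Set} → (∀ {e} → Q e → Q′ (inj₂ (inj₁ e))) →
              ∀ {x y} → Link Q x y → Link Q′ (inj₁ x) (inj₁ y)
  link-left f here       = here
  link-left f (edge q)   = edge (f q)
  link-left f (flip l)   = flip (link-left f l)
  link-left f (l then m) = link-left f l then link-left f m

  link-right : ∀ {s t Q} {Q′ : TEdge (join s t) → Set} → (∀ {e} → Q e → Q′ (inj₂ (inj₂ e))) →
               ∀ {x y} → Link Q x y → Link Q′ (inj₂ x) (inj₂ y)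
  link-right f here       = here
  link-right f (edge q)   = edge (f q)
  link-right f (flip l)   = flip (link-right f l)
  link-right f (l then m) = link-right f l then link-right f m

  to-root : ∀ t (x : Node t) → Link {t} (λ _ → ⊤) x (root t)
  to-root single     tt       = here
  to-root (join s t) (inj₁ x) = link-left id (to-root s x)
  to-root (join s t) (inj₂ y) = link-right id (to-root t y) then flip (edge {e = inj₁ tt} tt)

  not-below : ∀ {t} (e : TEdge t) x → below e x ≡ false → Link (_≢ e) x (root t)
  not-below {join s t} (inj₁ tt)       (inj₁ x) _  = link-left (λ _ ()) (to-root s x)
  not-below {join s t} (inj₂ (inj₁ e)) (inj₁ x) eq = link-left (λ { ne refl → ne refl }) (not-below e x eq)
  not-below {join s t} (inj₂ (inj₁ e)) (inj₂ y) eq =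
    link-right (λ _ ()) (to-root t y) then flip (edge {e = inj₁ tt} λ ())
  not-below {join s t} (inj₂ (inj₂ e)) (inj₁ x) eq = link-left (λ _ ()) (to-root s x)
  not-below {join s t} (inj₂ (inj₂ e)) (inj₂ y) eq =
    link-right (λ { ne refl → ne refl }) (not-below e y eq) then flip (edge {e = inj₁ tt} λ ())

  is-below : ∀ {t} (e : TEdge t) x → below e x ≡ true → Link (_≢ e) x (lower e)
  is-below {join s t} (inj₁ tt)       (inj₂ y) _  = link-right (λ _ ()) (to-root t y)
  is-below {join s t} (inj₂ (inj₁ e)) (inj₁ x) eq = link-left (λ { ne refl → ne refl }) (is-below e x eq)
  is-below {join s t} (inj₂ (inj₂ e)) (inj₂ y) eq = link-right (λ { ne refl → ne refl }) (is-below e y eq)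

  same-side : ∀ {t} (e : TEdge t) {x y} → below e x ≡ below e y → Link (_≢ e) x y
  same-side e {x} {y} eq with below e x in ex
  ... | true  = is-below e x ex then flip (is-below e y (sym eq))
  ... | false = not-below e x ex then flip (not-below e y (sym eq))

  nodes tedges : Tree → ℕ
  nodes single     = 1
  nodes (join s t) = nodes s + nodes t
  tedges single     = 0
  tedges (join s t) = 1 + (tedges s + tedges t)

  number : ∀ t → Node t ↔ Fin (nodes t)
  number single     = ↔-sym 1↔⊤
  number (join s t) = ↔-trans (number s ⊎-↔ number t) (↔-sym +↔⊎)

  numberᵉ : ∀ t → TEdge t ↔ Fin (tedges t)
  numberᵉ single     = ↔-sym 0↔⊥
  numberᵉ (join s t) = ↔-trans (↔-sym 1↔⊤ ⊎-↔ ↔-trans (numberᵉ s ⊎-↔ numberᵉ t) (↔-sym +↔⊎)) (↔-sym +↔⊎)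

  module TreeGraph (t : Tree) where
    private
      module N = Inverse (number t)
      module E = Inverse (numberᵉ t)

    enc : Node t → Fin (nodes t)
    enc = N.to

    dec : Fin (nodes t) → Node t
    dec = N.from

    dec-enc : ∀ x → dec (enc x) ≡ x
    dec-enc = N.strictlyInverseʳ

    enc-dec : ∀ x → enc (dec x) ≡ x
    enc-dec = N.strictlyInverseˡ

    decᵉ : Fin (tedges t) → TEdge t
    decᵉ = E.from

    decᵉ-injective : ∀ {d e} → decᵉ d ≡ decᵉ e → d ≡ e
    decᵉ-injective {d} {e} eq = trans (sym (E.strictlyInverseˡ d)) (trans (cong E.to eq) (E.strictlyInverseˡ e))

    side : Fin (tedges t) → Fin (nodes t) → Bool
    side e x = below (decᵉ e) (dec x)

    graph : Graph
    graph = record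
      { order = nodes t ; size = tedges t
      ; ends = λ e → enc (upper (decᵉ e)) , enc (lower (decᵉ e))
      ; loopless = λ e eq → true≢false (trans (sym (below-lower (decᵉ e)))
          (trans (cong (below (decᵉ e)) (trans (sym (dec-enc _)) (trans (cong dec (sym eq)) (dec-enc _))))
                 (below-upper (decᵉ e)))) }

    open GraphProperties graph

    side-upper : ∀ d e → side d (src e) ≡ below (decᵉ d) (upper (decᵉ e))
    side-upper d e = cong (below (decᵉ d)) (dec-enc _)

    side-lower : ∀ d e → side d (tgt e) ≡ below (decᵉ d) (lower (decᵉ e))
    side-lower d e = cong (below (decᵉ d)) (dec-enc _)

    cross-side : ∀ {d e} → cross (side d) e ≡ true → d ≡ e
    cross-side {d} {e} h with d ≟ e
    ... | yes eq = eq
    ... | no ne = contradiction (trans (sym h) (trans (cong₂ _xor_ (side-upper d e)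
            (trans (side-lower d e) (sym (below-other (ne ∘ decᵉ-injective))))) (xor-same (below (decᵉ d) (upper (decᵉ e))))))
            true≢false

    side-joins : ∀ {e u v} → Joins e u v → side e u ≢ side e v
    side-joins {e} J eq with joins-src {e} J
    ... | inj₁ (refl , refl) = true≢false (trans (sym (below-lower (decᵉ e)))
            (trans (sym (side-lower e e)) (trans (sym eq) (trans (side-upper e e) (below-upper (decᵉ e))))))
    ... | inj₂ (refl , refl) = true≢false (trans (sym (below-lower (decᵉ e)))
            (trans (sym (side-lower e e)) (trans eq (trans (side-upper e e) (below-upper (decᵉ e))))))

    link→route : ∀ {Q : TEdge t → Set} {Q′ : Edge → Set} → (∀ {e} → Q (decᵉ e) → Q′ e) →
                 ∀ {x y} → Link Q x y → Route Q′ (enc x) (enc y)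
    link→route f here = ε
    link→route {Q} f (edge {e} q) =
      (E.to e , inj₁ (cong₂ _,_ (cong (enc ∘ upper) eq) (cong (enc ∘ lower) eq)) , f (subst Q (sym eq) q)) ◂ ε
      where
      eq : decᵉ (E.to e) ≡ e
      eq = E.strictlyInverseʳ e
    link→route f (flip l)   = route-sym (link→route f l)
    link→route f (l then m) = chain-++ (link→route f l) (link→route f m)

    reachable⇒side : ∀ {e u v} → ReachableAvoiding ⁅ e ⁆ u v → side e u ≡ side e v
    reachable⇒side {e} {u} {v} ((w , _) , avoid) with side e u ≟ᵇ side e v
    ... | yes eq = eq
    ... | no ne with walk-crosses (side e) w ne
    ...   | d , d∈ , c with cross-side {e} {d} c
    ...     | refl = contradiction (x∈⁅x⁆ e) (All.lookup avoid d∈)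

    side⇒reachable : ∀ {e u v} → side e u ≡ side e v → ReachableAvoiding ⁅ e ⁆ u v
    side⇒reachable {e} {u} {v} eq = route→path (subst₂ (Route _) (enc-dec u) (enc-dec v)
      (link→route (λ ne d∈ → ne (cong decᵉ (x∈⁅y⁆⇒x≡y e d∈))) (same-side (decᵉ e) eq)))

    isTree : IsTree
    isTree = record
      { nonEmpty  = positive (enc (root t))
      ; connected = λ u v → proj₁ (route→path (subst₂ (Route (λ _ → ⊤)) (enc-dec u) (enc-dec v)
          (link→route (λ _ → tt) (to-root t (dec u) then flip (to-root t (dec v))))))
      -- A path between the ends of `e` changes sides of `e` and therefore contains `e`.
      ; acyclic   = λ (u , v , (w , _) , e , J , e∉) → case walk-crosses (side e) w (side-joins {e} J) of
          λ (d , d∈ , c) → e∉ (subst (_∈ walkEdges w) (sym (cross-side {e} {d} c)) d∈) }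
      where
      positive : ∀ {n} → Fin n → 0 < n
      positive zero    = s≤s z≤n
      positive (suc _) = s≤s z≤n

-- From partial decompositions to tree-cut decompositions.

module Assembly (G : Graph) (k : ℕ) where
  open GraphProperties G
  open Splits G k
  open Duality G k
  open Haven G k using (nonempty; nonempty-∈)
  open RootedTrees

  -- The split describes the actual tree at `x`: an incident tree edge divides the vertices into a
  -- branch and the rest, and the two alternatives allow for edges leading down or up. Restricting
  -- `bag-here` to `W` exempts vertices that are merely parked at a root.
  record LocalAt (W : VSet) (t : Tree) (ν : Vertex → Node t) (x : Node t) : Set₁ where
    field
      split : Split
    open Split split public
    field
      small    : # (part bag) ≤ k
      bag-here : ∀ v → W v ≡ true → ν v ≡ x → colour v ≡ bag
      branches : ∀ e → upper e ≡ x ⊎ lower e ≡ x → Σ[ l ∈ Label ] l ≢ bag ×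
                 ((∀ v → below e (ν v) ≡ part l v) ⊎ (∀ v → below e (ν v) ≡ not (part l v)))

  -- Vertices outside `W` are parked at the root until the piece is attached; `outer` is the branch
  -- at the root that they will form.
  record Piece (W : VSet) : Set₁ where
    field
      tree    : Tree
      ν       : Vertex → Node tree
      outside-W : ∀ v → W v ≡ false → ν v ≡ root tree
      local   : ∀ x → LocalAt W tree ν x
    open LocalAt (local (root tree)) using (bag; part; Label)
    field
      outer     : Label
      outer≢bag : outer ≢ bag
      outer-W   : W ≗ ∁ (part outer)

  module _ (s : Split) (o : Split.Label s) where
    open Split s

    -- The tree once the branches with labels in `done` hang from a root with split `s`; vertices
    -- with other labels still wait at the root.
    record Partial (done : Label → Bool) : Set₁ where
      field
        tree   : Tree
        ν      : Vertex → Node tree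
        rooted : ∀ v → done (colour v) ≡ false → ν v ≡ root tree
        placed : ∀ v → ν v ≡ root tree → done (colour v) ≡ false
        root-branches : ∀ e → upper e ≡ root tree →
                        Σ[ l ∈ Label ] l ≢ bag × (∀ v → below e (ν v) ≡ part l v)
        local  : ∀ x → x ≢ root tree → LocalAt everything tree ν x

    start : Partial (λ _ → false)
    start = record
      { tree = single ; ν = λ _ → tt ; rooted = λ _ _ → refl ; placed = λ _ _ → refl
      ; root-branches = λ () ; local = λ _ ne → contradiction refl ne }

    attach : ∀ {done} l → l ≢ bag → done l ≡ false → Partial done → Piece (part l) →
             Partial (λ m → done m ∨ does (m ≟ˡ l))
    attach {done} l l≢bag fresh acc new = record
      { tree = join A.tree B.tree ; ν = ν ; rooted = rooted ; placed = placed
      ; root-branches = root-branches ; local = local }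
      where
      module A = Partial acc
      module B = Piece new
      place : Bool → Vertex → Node (join A.tree B.tree)
      place b v = if b then inj₂ (B.ν v) else inj₁ (A.ν v)
      ν : Vertex → Node (join A.tree B.tree)
      ν v = place (part l v) v
      below-new : ∀ v → below {join A.tree B.tree} (inj₁ tt) (ν v) ≡ part l v
      below-new v with part l v
      ... | true  = refl
      ... | false = refl
      below-left : ∀ e v → below {join A.tree B.tree} (inj₂ (inj₁ e)) (ν v) ≡ below e (A.ν v)
      below-left e v with part l v in eq
      ... | false = refl
      -- The vertex leaves the root of the left tree, which is below none of its edges, so nothing
      -- changes for `e`.
      ... | true  = sym (trans (cong (below e) (A.rooted v (trans (cong done (part-colour eq)) fresh))) (below-root e))
      below-right : ∀ e v → below {join A.tree B.tree} (inj₂ (inj₂ e)) (ν v) ≡ below e (B.ν v)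
      below-right e v with part l v in eq
      ... | true  = refl
      ... | false = sym (trans (cong (below e) (B.outside-W v eq)) (below-root e))
      rooted : ∀ v → (done (colour v) ∨ part l v) ≡ false → ν v ≡ inj₁ (root A.tree)
      rooted v h with part l v | done (colour v) in dn
      ... | false | false = cong inj₁ (A.rooted v dn)
      rooted v () | true | true
      placed : ∀ v → ν v ≡ inj₁ (root A.tree) → (done (colour v) ∨ part l v) ≡ false
      placed v h with part l v
      ... | false = trans (∨-identityʳ _) (A.placed v (inj₁-injective h))
      root-branches : ∀ e → upper e ≡ inj₁ (root A.tree) →
                      Σ[ m ∈ Label ] m ≢ bag × (∀ v → below e (ν v) ≡ part m v)
      root-branches (inj₁ tt) _ = l , l≢bag , below-new
      root-branches (inj₂ (inj₁ e)) h with A.root-branches e (inj₁-injective h)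
      ... | m , m≢bag , eq = m , m≢bag , λ v → trans (below-left e v) (eq v)
      local : ∀ x → x ≢ inj₁ (root A.tree) → LocalAt everything (join A.tree B.tree) ν x
      local (inj₁ x) ne = record
        { split = L.split ; small = L.small ; bag-here = λ v _ h → L.bag-here v refl (from-left v h)
        ; branches = branches }
        where
        module L = LocalAt (A.local x (ne ∘ cong inj₁))
        from-left : ∀ v → ν v ≡ inj₁ x → A.ν v ≡ x
        from-left v h with part l v
        from-left v refl | false = refl
        branches : ∀ e → upper e ≡ inj₁ x ⊎ lower e ≡ inj₁ x → Σ[ m ∈ L.Label ] m ≢ L.bag ×
                   ((∀ v → below e (ν v) ≡ L.part m v) ⊎ (∀ v → below e (ν v) ≡ not (L.part m v)))
        branches (inj₁ tt) (inj₁ h) = contradiction (sym h) ne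
        branches (inj₂ (inj₁ e)) h with L.branches e ([ inj₁ ∘ inj₁-injective , inj₂ ∘ inj₁-injective ]′ h)
        ... | m , m≢bag , inj₁ eq = m , m≢bag , inj₁ (λ v → trans (below-left e v) (eq v))
        ... | m , m≢bag , inj₂ eq = m , m≢bag , inj₂ (λ v → trans (below-left e v) (eq v))
        branches (inj₂ (inj₂ e)) (inj₁ ())
        branches (inj₂ (inj₂ e)) (inj₂ ())
      local (inj₂ y) ne = record
        { split = L.split ; small = L.small
        ; bag-here = λ v _ h → L.bag-here v (proj₁ (from-right v h)) (proj₂ (from-right v h))
        ; branches = branches }
        where
        module L = LocalAt (B.local y)
        from-right : ∀ v → ν v ≡ inj₂ y → part l v ≡ true × B.ν v ≡ y
        from-right v h with part l v
        from-right v refl | true = refl , refl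
        branches : ∀ e → upper e ≡ inj₂ y ⊎ lower e ≡ inj₂ y → Σ[ m ∈ L.Label ] m ≢ L.bag ×
                   ((∀ v → below e (ν v) ≡ L.part m v) ⊎ (∀ v → below e (ν v) ≡ not (L.part m v)))
        -- Seen from the root of the new piece, the attaching edge leads to the branch `outer`.
        branches (inj₁ tt) (inj₂ refl) = B.outer , B.outer≢bag , inj₂ (λ v → trans (below-new v) (B.outer-W v))
        branches (inj₂ (inj₂ e)) h with L.branches e ([ inj₁ ∘ inj₂-injective , inj₂ ∘ inj₂-injective ]′ h)
        ... | m , m≢bag , inj₁ eq = m , m≢bag , inj₁ (λ v → trans (below-right e v) (eq v))
        ... | m , m≢bag , inj₂ eq = m , m≢bag , inj₂ (λ v → trans (below-right e v) (eq v))
        branches (inj₂ (inj₁ e)) (inj₁ ())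
        branches (inj₂ (inj₁ e)) (inj₂ ())

    record Complete (ls : List Label) : Set₁ where
      field
        done     : Label → Bool
        partial  : Partial done
        done-bag : done bag ≡ false
        done-o   : done o ≡ false
        done-all : ∀ {l} → l ∈ ls → l ≢ bag → l ≢ o → done l ≡ true

    attach-all : (∀ l → l ≢ bag → l ≢ o → Piece (part l)) → ∀ ls → Complete ls
    attach-all pieces [] = record
      { done = λ _ → false ; partial = start ; done-bag = refl ; done-o = refl ; done-all = λ () }
    attach-all pieces (l ∷ ls) = extend (l ≟ˡ bag) (l ≟ˡ o) (done l) refl
      where
      open Complete (attach-all pieces ls)
      extend : Dec (l ≡ bag) → Dec (l ≡ o) → ∀ b → done l ≡ b → Complete (l ∷ ls)
      extend (yes l≡bag) _ _ _ = record { Complete (attach-all pieces ls) hiding (done-all)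
        ; done-all = λ { (here refl) p _ → contradiction l≡bag p ; (there m∈) → done-all m∈ } }
      extend _ (yes l≡o) _ _ = record { Complete (attach-all pieces ls) hiding (done-all)
        ; done-all = λ { (here refl) _ p → contradiction l≡o p ; (there m∈) → done-all m∈ } }
      -- A label may occur repeatedly in the list; its branch is attached only once.
      extend _ _ true dn = record { Complete (attach-all pieces ls) hiding (done-all)
        ; done-all = λ { (here refl) _ _ → dn ; (there m∈) → done-all m∈ } }
      extend (no l≢bag) (no l≢o) false dn = record
        { done = λ m → done m ∨ does (m ≟ˡ l)
        ; partial = attach l l≢bag dn partial (pieces l l≢bag l≢o)
        ; done-bag = cong₂ _∨_ done-bag (dec-false (bag ≟ˡ l) (l≢bag ∘ sym))
        ; done-o = cong₂ _∨_ done-o (dec-false (o ≟ˡ l) (l≢o ∘ sym))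
        ; done-all = λ { (here refl) _ _ → trans (cong (done l ∨_) (dec-true (l ≟ˡ l) refl)) (∨-zeroʳ _)
                       ; (there m∈) p q → cong (_∨ _) (done-all m∈ p q) } }

    piece-node : ∀ {W} → # (part bag) ≤ k → o ≢ bag → W ≗ ∁ (part o) →
                 (∀ l → l ≢ bag → l ≢ o → Piece (part l)) → Piece W
    piece-node {W} small o≢bag W≗ pieces = record
      { tree = tree ; ν = ν ; outside-W = λ v h → rooted v (trans (cong done (at-outer v h)) done-o)
      ; local = local′ ; outer = outer′ .proj₁ ; outer≢bag = outer′ .proj₂ .proj₁ ; outer-W = outer′ .proj₂ .proj₂ }
      where
      open Complete (attach-all pieces labels)
      open Partial partial
      at-outer : ∀ v → W v ≡ false → colour v ≡ o
      at-outer v h = part-colour (not-injective {part o v} {true} (trans (sym (W≗ v)) h))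
      at-root : LocalAt W tree ν (root tree)
      at-root = record
        { split = s ; small = small
        -- All labels other than `bag` and `o` are done, and vertices with such labels have left the
        -- root; vertices of `W` do not have label `o`.
        ; bag-here = λ v Wv h → decidable-stable (colour v ≟ˡ bag) (λ ≢bag → true≢false (trans
            (sym (done-all (complete (colour v)) ≢bag
              (λ ≡o → true≢false (trans (sym Wv) (trans (W≗ v) (cong not (in-part ≡o)))))))
            (placed v h)))
        ; branches = λ { e (inj₁ h) → case root-branches e h of λ (l , l≢bag , eq) → l , l≢bag , inj₁ eq
                       ; e (inj₂ h) → contradiction (trans (sym (below-lower e))
                                        (trans (cong (below e) h) (below-root e))) true≢false } }
      narrow : ∀ {x} → LocalAt everything tree ν x → LocalAt W tree ν x
      narrow loc = record { split = L.split ; small = L.small ; bag-here = λ v _ → L.bag-here v refl ; branches = L.branches }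
        where module L = LocalAt loc
      choose : ∀ x → Dec (x ≡ root tree) → LocalAt W tree ν x
      choose x (yes refl) = at-root
      choose x (no ne)    = narrow (local x ne)
      root? : ∀ x → Dec (x ≡ root tree)
      root? x = map′ (λ eq → trans (sym (dec-enc x)) (trans (cong dec eq) (dec-enc _))) (cong enc) (enc x ≟ enc (root tree))
        where open TreeGraph tree
      local′ : ∀ x → LocalAt W tree ν x
      local′ x = choose x (root? x)
      outer′ : let open LocalAt (local′ (root tree)) using () renaming (Label to L; bag to b; part to p) in
               Σ[ o′ ∈ L ] o′ ≢ b × W ≗ ∁ (p o′)
      -- The split in `local′ (root tree)` reduces to `s` only once `root?` has been evaluated.
      outer′ with root? (root tree)
      ... | yes refl = o , o≢bag , W≗
      ... | no ne    = contradiction refl ne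

  piece-empty : ∀ {W} → W ∉ᶠ nonempty → Piece W
  piece-empty {W} W∉ = record
    { tree = single ; ν = λ _ → tt ; outside-W = λ _ _ → refl
    ; local = λ _ → record
        { split = split ; small = ≤-trans (≤-reflexive (#-empty {f = λ (v : Vertex) → false} (λ _ → refl))) z≤n
        ; bag-here = λ v Wv _ → contradiction (nonempty-∈ {W} {v} Wv) W∉ ; branches = λ () }
    ; outer = false ; outer≢bag = λ () ; outer-W = λ v → ¬-not (λ Wv → W∉ (nonempty-∈ {W} {v} Wv)) }
    where
    split : Split
    split = record
      { Label = Bool ; _≟ˡ_ = _≟ᵇ_ ; labels = true ∷ false ∷ []
      ; complete = λ { true → here refl ; false → there (here refl) }
      ; bag = true ; colour = λ _ → false ; counted = λ _ → false ; uncounted-bag = refl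
      ; few = ≤-trans (≤-reflexive (#-empty {f = λ (e : Edge) → false} (λ _ → refl))) z≤n
      ; thin = λ { true ne _ → contradiction refl ne
                 ; false _ _ → ≤-trans (≤-reflexive (#-empty {f = λ (e : Edge) → false} (λ _ → refl))) z≤n } }

  piece : ∀ {W} → Sol nonempty W → Piece W
  piece (leaf W∉ _) = piece-empty W∉
  piece (node s o small o≢ W≗ ch) = piece-node s o small o≢ W≗ (λ l p q → piece (ch l p q))

  decomposition : Piece everything → HasDecompositionOfWidth≤ G k
  decomposition p = D , adhesion , bags
    where
    open Piece p
    open TreeGraph tree
    module T = GraphProperties graph
    place : Vertex → Fin (nodes tree)
    place v = enc (ν v)
    at? : ∀ t v → Dec (place v ≡ t)
    at? t v = place v ≟ t
    D : TreeCutDecomposition G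
    D = record
      { tree = graph ; isTree = isTree
      ; bag = λ t → tabulate (λ v → does (at? t v))
      ; disjoint = λ {s} {t} s≢t (v , v∈) → case x∈p∩q⁻ _ _ v∈ of λ (v∈s , v∈t) →
          s≢t (trans (sym (from-does (at? s v) (∈-tabulate⁻ v∈s))) (from-does (at? t v) (∈-tabulate⁻ v∈t)))
      ; cover = λ v → place v , ∈-tabulate⁺ (dec-true (at? (place v) v) refl) }
    open TreeCutDecomposition D using (edgeAdh; Bold; nodeAdh; AdhesionWidth≤; BagWidth≤)
    sideOf : T.Edge → VSet
    sideOf st v = below (decᵉ st) (ν v)
    side-place : ∀ st v → side st (place v) ≡ sideOf st v
    side-place st v = cong (below (decᵉ st)) (dec-enc (ν v))
    adh⇒cross : ∀ {st g} → edgeAdh st g → cross (sideOf st) g ≡ true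
    adh⇒cross {st} {g} adh = xor-≢ (λ eq → adh (side⇒reachable
        (trans (side-place st (src g)) (trans eq (sym (side-place st (tgt g)))))))
    cross⇒adh : ∀ {st g} → cross (sideOf st) g ≡ true → edgeAdh st g
    cross⇒adh {st} {g} c reach = true≢false (trans (sym c) (trans
      (cong (_xor sideOf st (tgt g)) (trans (sym (side-place st (src g))) (trans (reachable⇒side reach) (side-place st (tgt g)))))
      (xor-same (sideOf st (tgt g)))))
    adh? : ∀ st → Decidable (edgeAdh st)
    adh? st g = map′ (cross⇒adh {st}) (adh⇒cross {st}) (cross (sideOf st) g ≟ᵇ true)
    nodeAdh? : ∀ t → Decidable (nodeAdh t)
    nodeAdh? t g = any? (λ st → any? (λ u → T.joins? st t u) ×-dec at-least? (adh? st) 3 ×-dec adh? st g)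
    adhesion : AdhesionWidth≤ k
    adhesion t = bounded-by (nodeAdh? t) counts counted-adh few
      where
      open LocalAt (local (dec t))
      incident : ∀ {st} → T.Incident st t → upper (decᵉ st) ≡ dec t ⊎ lower (decᵉ st) ≡ dec t
      incident {st} (u , inj₁ eq) = inj₁ (trans (sym (dec-enc _)) (cong (dec ∘ proj₁) eq))
      incident {st} (u , inj₂ eq) = inj₂ (trans (sym (dec-enc _)) (cong (dec ∘ proj₂) eq))
      -- A branch at a bold edge has a cut of at least three edges, so by `thin` it must be counted.
      counted-by : ∀ st g l → l ≢ bag → 3 ≤ cut (sideOf st) → cross (sideOf st) ≗ cross (part l) →
                   cross (sideOf st) g ≡ true → counts g ≡ true
      counted-by st g l l≢bag big eq c = cross-counts l
        (¬-not (λ un → <⇒≱ (subst (3 ≤_) (#-cong eq) big) (thin l l≢bag un))) g (trans (sym (eq g)) c)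
      counted-adh : ∀ g → nodeAdh t g → counts g ≡ true
      counted-adh g (st , inc , bold , adh) with branches (decᵉ st) (incident {st} inc)
      ... | l , l≢bag , inj₁ eq = counted-by st g l l≢bag (size-of (adh? st) _ (λ _ → adh⇒cross {st}) bold)
              (λ e → cong₂ _xor_ (eq (src e)) (eq (tgt e))) (adh⇒cross {st} adh)
      ... | l , l≢bag , inj₂ eq = counted-by st g l l≢bag (size-of (adh? st) _ (λ _ → adh⇒cross {st}) bold)
              (λ e → trans (cong₂ _xor_ (eq (src e)) (eq (tgt e))) (xor-not (part l (src e)) (part l (tgt e))))
              (adh⇒cross {st} adh)
    bags : BagWidth≤ k
    bags t = ≤-trans (≤-reflexive (∣tabulate∣ (λ v → does (at? t v))))
      (≤-trans (#-mono (λ v h → in-part (bag-here v refl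
          (trans (sym (dec-enc (ν v))) (cong dec (from-does (at? t v) h)))))) small)
      where open LocalAt (local (dec t))

-- Paths and separation in trees.

lookup-injective : ∀ {a} {A : Set a} {xs : List A} → Unique xs → ∀ {i j} → lookupˡ xs i ≡ lookupˡ xs j → i ≡ j
lookup-injective (x∉ ∷ un) {zero}  {zero}  eq = refl
lookup-injective (x∉ ∷ un) {zero}  {suc j} eq = contradiction eq (All.lookup x∉ (∈-lookup j))
lookup-injective (x∉ ∷ un) {suc i} {zero}  eq = contradiction (sym eq) (All.lookup x∉ (∈-lookup i))
lookup-injective (x∉ ∷ un) {suc i} {suc j} eq = cong suc (lookup-injective un eq)

unique-length : ∀ {n} {xs : List (Fin n)} → Unique xs → length xs ≤ n
unique-length un = injective⇒≤ (lookup-injective un)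

module WalkProperties (G : Graph) where
  open GraphProperties G

  start∈ : ∀ {u v} (w : Walk u v) → u ∈ walkVertices w
  start∈ stop         = here refl
  start∈ (step _ _ _) = here refl

  edge-end∈ : ∀ {u v e a b} (w : Walk u v) → e ∈ walkEdges w → Joins e a b → a ∈ walkVertices w
  edge-end∈ (step e J w) (here refl) J′ with joins-unique {e} J J′
  ... | inj₁ (refl , _) = here refl
  ... | inj₂ (_ , refl) = there (start∈ w)
  edge-end∈ (step e J w) (there e∈) J′ = there (edge-end∈ w e∈ J′)

  prefix : ∀ {u v x} {Q : Edge → Set} (w : Walk u v) → All Q (walkEdges w) → x ∈ walkVertices w → Route Q u x
  prefix stop         _        (here refl) = ε
  prefix (step e J w) _        (here refl) = ε
  prefix (step e J w) (q ∷ qs) (there x∈)  = (e , J , q) ◂ prefix w qs x∈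

module TreeProperties (T : Graph) (isTree : Graph.IsTree T) where
  open GraphProperties T
  open WalkProperties T
  open IsTree isTree

  Beside : Edge → Vertex → Vertex → Set
  Beside e = Route (_≢ e)

  beside→reach : ∀ {e u v} → Beside e u v → ReachableAvoiding ⁅ e ⁆ u v
  beside→reach {e} = route→path ∘ route-map (λ ne d∈ → ne (x∈⁅y⁆⇒x≡y e d∈))

  reach→beside : ∀ {e u v} → ReachableAvoiding ⁅ e ⁆ u v → Beside e u v
  reach→beside {e} = route-map (λ d∉ → λ { refl → d∉ (x∈⁅x⁆ e) }) ∘ reach→route ⁅ e ⁆

  beside? : ∀ e u v → Dec (Beside e u v)
  beside? e u v = map′ reach→beside beside→reach (reach? ⁅ e ⁆ u v)

  -- A path from `u` to `v` avoiding `e` would form a cycle together with `e`.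
  edge-separates : ∀ {e u v} → Joins e u v → ¬ Beside e u v
  edge-separates {e} {u} {v} J r with route→path r
  ... | p , avoid = acyclic (u , v , p , e , J , λ e∈ → All.lookup avoid e∈ refl)

  record Towards (t x : Vertex) : Set where
    field
      next  : Vertex
      via   : Edge
      joins : Joins via t next
      rest  : Beside via next x

  towards : ∀ t x → t ≢ x → Towards t x
  towards t x t≢x with connected t x
  ... | stop , _ = contradiction refl t≢x
  ... | step {v = s} e J w , (t∉ ∷ _) = record
    { next = s ; via = e ; joins = J
    -- The path does not return to `t`, so it does not use `e` again.
    ; rest = walk→route w (All.tabulate λ d∈ → λ { refl → All.All¬⇒¬Any t∉ (edge-end∈ w d∈ J) }) }

  move : Vertex → Vertex → Vertex
  move t x with t ≟ x
  ... | yes _   = t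
  ... | no t≢x  = Towards.next (towards t x t≢x)

  moves : ∀ {t x} → t ≢ x → Σ[ e ∈ Edge ] Joins e t (move t x) × Beside e (move t x) x
  moves {t} {x} t≢x with t ≟ x
  ... | yes eq = contradiction eq t≢x
  ... | no ne  = via , joins , rest
    where open Towards (towards t x ne)

-- The winning strategy of the cops.

module CopsWin (G : Graph) (k : ℕ) (D : TreeCutDecomposition G)
               (adhesion : TreeCutDecomposition.AdhesionWidth≤ D k)
               (bags : TreeCutDecomposition.BagWidth≤ D k) where
  open GraphProperties G
  open Menger G using (threeEdgeConnected?)
  open Game G
  open TreeCutDecomposition D
  private
    module T where
      open GraphProperties tree public
      open WalkProperties tree public
      open TreeProperties tree isTree public

  adhesionSet : T.Vertex → Subset size
  adhesionSet t = proj₁ (adhesion t)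

  in-adhesionSet : ∀ {t st s g} → T.Joins st t s → Bold st → edgeAdh st g → g ∈ˢ adhesionSet t
  in-adhesionSet {t} {st} {s} J bold adh = proj₂ (proj₁ (proj₂ (adhesion t))) (st , (s , J) , bold , adh)

  edgeAdh? : ∀ st → Decidable (edgeAdh st)
  edgeAdh? st g = ¬? (T.reach? ⁅ st ⁆ (node (src g)) (node (tgt g)))

  beside-edge : ∀ {st g u v} → ¬ edgeAdh st g → Joins g u v → T.Beside st (node u) (node v)
  beside-edge {st} {g} ¬adh J with T.reach→beside (decidable-stable (T.reach? ⁅ st ⁆ _ _) ¬adh) | joins-src {g} J
  ... | b | inj₁ (refl , refl) = b
  ... | b | inj₂ (refl , refl) = T.route-sym b

  beside-route : ∀ {st u v} → Route (λ g → ¬ edgeAdh st g) u v → T.Beside st (node u) (node v)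
  beside-route ε = ε
  beside-route ((g , J , ¬adh) ◂ r) = chain-++ (beside-edge {g = g} ¬adh J) (beside-route r)

  walk-adh : ∀ {st u v} → ¬ T.Beside st (node u) (node v) → (w : Walk u v) → ∃[ g ] g ∈ walkEdges w × edgeAdh st g
  walk-adh {st} apart w with Any.any? (edgeAdh? st) (walkEdges w)
  ... | yes some = find some
  ... | no none  = contradiction (beside-route (walk→route w (All.¬Any⇒All¬ _ none))) apart

  -- Each of the three paths passes from one side of `st` to the other, through an edge of its
  -- adhesion.
  bold : ∀ {st u v} → ThreeEdgeConnected u v → ¬ T.Beside st (node u) (node v) → Bold st
  bold (inj₁ refl) apart = contradiction ε apart
  bold {st} (inj₂ (p , q , r , pq , pr , qr)) apart
    with walk-adh apart (proj₁ p) | walk-adh apart (proj₁ q) | walk-adh apart (proj₁ r)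
  ... | e , e∈ , ae | f , f∈ , af | g , g∈ , ag =
    tabulate ⟦ edgeAdh? st ⟧ , realise (edgeAdh? st) , ≤-trans
      (three-distinct {f = ⟦ edgeAdh? st ⟧}
        (λ { refl → pq (e∈ , f∈) }) (λ { refl → pr (e∈ , g∈) }) (λ { refl → qr (f∈ , g∈) })
        (dec-true (edgeAdh? st e) ae) (dec-true (edgeAdh? st f) af) (dec-true (edgeAdh? st g) ag))
      (≤-reflexive (sym (∣tabulate∣ ⟦ edgeAdh? st ⟧)))

  -- If the move crossed `st`, then `st` would be bold by 3-edge-connectedness and its whole
  -- adhesion would lie in `F`; a route avoiding `F` could not cross it.
  stays-beside : ∀ {st F u v} → ThreeEdgeConnected u v → ReachableAvoiding F u v →
                 (∀ {g} → Bold st → edgeAdh st g → g ∈ˢ F) → T.Beside st (node u) (node v)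
  stays-beside {st} {F} {u} {v} con reach guarded with T.beside? st (node u) (node v)
  ... | yes b = b
  ... | no apart = beside-route (route-map (λ g∉ adh → g∉ (guarded (bold con apart) adh)) (reach→route F reach))

  -- The cops begin at the robber's initial node and then take one tree edge per round towards her,
  -- or stay if they are at her node.
  position : ∀ {i} → Vec Vertex (suc i) → T.Vertex
  position {zero}  (r ∷ []) = node r
  position {suc i} (r ∷ h)  = T.move (position h) (node r)

  strategy : Strategy k
  strategy = record { announce = adhesionSet ∘ position ; bounded = λ h → proj₂ (proj₂ (adhesion (position h))) }

  -- If a vertex of her class within reach were in another bag, she could cross the first tree edge
  -- from `t` towards it, although its adhesion is guarded if the edge is bold.
  caught : ∀ {t r} → t ≡ node r → Caught k (adhesionSet t) r
  caught {t} {r} refl = bounded-by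
      (λ v → threeEdgeConnected? r v ×-dec reach? (adhesionSet t) r v) (lookup (bag t)) in-bag
      (≤-trans (≤-reflexive (∣lookup∣ (bag t))) (bags t))
    where
    in-bag : ∀ v → ThreeEdgeConnected r v × ReachableAvoiding (adhesionSet t) r v → lookup (bag t) v ≡ true
    in-bag v (con , reach) with t ≟ node v
    ... | yes eq = []=⇒lookup (subst (λ s → v ∈ˢ bag s) (sym eq) (proj₂ (cover v)))
    ... | no ne with T.moves ne
    ...   | e , J , b = contradiction (chain-++ (stays-beside con reach (in-adhesionSet J)) (T.route-sym b))
                          (T.edge-separates J)

  module _ (r : ℕ → Vertex) (legal : LegalPlay strategy r) where

    at : ℕ → T.Vertex
    at i = position (history r i)

    -- The cops never turn back, so their trail in the tree is a path, which ends.
    chase : ∀ fuel i {z} (w : T.Walk (at i) z) → Unique (T.walkVertices w) →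
            T.order < length (T.walkVertices w) + fuel →
            (∀ {e s} → T.Joins e (at i) s → T.Beside e s (node (r (suc i))) → e ∉ T.walkEdges w) →
            ∃[ j ] Caught k (cops strategy r (suc j)) (r (suc j))
    -- The trail has distinct vertices and grows with every unit of fuel used, so it would have more
    -- vertices than the tree.
    chase zero i w un lt _ = contradiction (unique-length un) (<⇒≱ (subst (T.order <_) (+-identityʳ _) lt))
    chase (suc fuel) i w un lt ahead with at i ≟ node (r (suc i))
    ... | yes eq = i , caught eq
    ... | no ne with T.moves ne
    ...   | e , J , b = chase fuel (suc i) (T.step e (T.joins-sym {e} J) w) (All.¬Any⇒All¬ _ new ∷ un)
              (subst (T.order <_) (+-suc _ fuel) lt) ahead′
      where
      fresh : e ∉ T.walkEdges w
      fresh = ahead J b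
      new : at (suc i) ∉ T.walkVertices w
      new s∈ = T.edge-separates J (T.prefix w (All.tabulate λ d∈ → λ { refl → fresh d∈ }) s∈)
      -- If `e` is bold, its adhesion belongs to the sets occupied at both of its ends, and so to
      -- the intersection that the robber must avoid.
      still : T.Beside e (at (suc i)) (node (r (suc (suc i))))
      still = chain-++ b (stays-beside (proj₂ (legal (suc i))) (proj₁ (legal (suc i)))
        (λ bold adh → x∈p∩q⁺ (in-adhesionSet J bold adh , in-adhesionSet (T.joins-sym {e} J) bold adh)))
      ahead′ : ∀ {d s} → T.Joins d (at (suc i)) s → T.Beside d s (node (r (suc (suc i)))) →
               d ∉ e ∷ T.walkEdges w
      ahead′ J′ b′ (there d∈) = new (T.edge-end∈ w d∈ J′)
      -- Turning back along `e` would require the robber to be on both sides of `e`.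
      ahead′ J′ b′ (here refl) with T.joins-unique {e} J J′
      ... | inj₁ (eq , _) = new (subst (_∈ T.walkVertices w) eq (T.start∈ w))
      ... | inj₂ (refl , _) = T.edge-separates J (chain-++ b′ (T.route-sym still))

    catches : ∃[ j ] Caught k (cops strategy r (suc j)) (r (suc j))
    catches = chase T.order 0 T.stop ([] ∷ []) ≤-refl (λ _ _ ())

  searchable : Searchable G k k
  searchable = strategy , catches

-- The robber's escape, given a haven.

module RobberWins (G : Graph) (k : ℕ) (haven : Haven.Haven G k) where
  open GraphProperties G
  open Game G
  open Haven.Haven haven

  module _ (σ : Strategy k) where
    open Strategy σ

    target : ∀ F → ∣ F ∣ ≤ k → ∃[ v ] (big F v ∧ core v) ≡ true
    target F F≤k = #-witness (≤-trans (s≤s z≤n) (large F F≤k))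

    ∅≤k : ∣ ∅ {size} ∣ ≤ k
    ∅≤k = ≤-trans (≤-reflexive (∣⊥∣≡0 size)) z≤n

    -- An announcement depends on the whole history, so the recursion builds histories and `robber`
    -- is read off from them.
    past : ∀ i → Vec Vertex (suc i)
    past zero    = proj₁ (target ∅ ∅≤k) ∷ []
    past (suc i) = proj₁ (target (announce (past i)) (bounded (past i))) ∷ past i

    robber : ℕ → Vertex
    robber i = head (past i)

    history-past : ∀ i → history robber i ≡ past i
    history-past zero    = refl
    history-past (suc i) = cong (robber (suc i) ∷_) (history-past i)

    few-cops : ∀ i → ∣ cops σ robber i ∣ ≤ k
    few-cops zero    = ∅≤k
    few-cops (suc i) = bounded (history robber i)

    safe : ∀ i → (big (cops σ robber i) (robber i) ∧ core (robber i)) ≡ true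
    safe zero = proj₂ (target ∅ ∅≤k)
    safe (suc i) rewrite history-past i = proj₂ (target (announce (past i)) (bounded (past i)))

    legal : LegalPlay σ robber
    legal i with meet (cops σ robber i) (cops σ robber (suc i)) (few-cops i) (few-cops (suc i))
    ... | z , z∈ , z∈′ =
      -- A route avoiding `F` leads to the common vertex `z`, and one avoiding `F′` leads on from
      -- there; both avoid the intersection.
      route→path (chain-++
        (route-map (λ e∉ e∈ → e∉ (proj₁ (x∈p∩q⁻ F F′ e∈))) (connected F (∧-leftᵗ (safe i)) z∈))
        (route-map (λ e∉ e∈ → e∉ (proj₂ (x∈p∩q⁻ F F′ e∈))) (connected F′ z∈′ (∧-leftᵗ (safe (suc i))))))
      , core-con (∧-rightᵗ {big F (robber i)} (safe i)) (∧-rightᵗ {big F′ (robber (suc i))} (safe (suc i)))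
      where
      F F′ : Subset size
      F  = cops σ robber i
      F′ = cops σ robber (suc i)

    -- The vertices of the core in `big F` are all in her class and within her reach, and there are
    -- more than `k` of them.
    escapes : ¬ Winning k σ
    escapes win with win robber legal
    ... | i , S , (_ , P⊆S) , S≤k = <⇒≱ (large F (few-cops (suc i)))
        (≤-trans (#-mono trapped) (≤-trans (≤-reflexive (∣lookup∣ S)) S≤k))
      where
      F : Subset size
      F = cops σ robber (suc i)
      trapped : (λ v → big F v ∧ core v) ⊑ lookup S
      trapped v h = []=⇒lookup (P⊆S
        ( core-con (∧-rightᵗ {big F (robber (suc i))} (safe (suc i))) (∧-rightᵗ {big F v} h)
        , route→path (connected F (∧-leftᵗ (safe (suc i))) (∧-leftᵗ h))))

  not-searchable : ¬ Searchable G k k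
  not-searchable (σ , win) = escapes σ win

-- The equivalence, and the existence of the least width.

module _ (G : Graph) where

  decomposition⇒searchable : ∀ {k} → HasDecompositionOfWidth≤ G k → Searchable G k k
  decomposition⇒searchable {k} (D , adhesion , bags) = CopsWin.searchable G k D adhesion bags

  decomposition-or-haven : ∀ k → HasDecompositionOfWidth≤ G k ⊎ Haven.Haven G k
  decomposition-or-haven k =
    [ (λ sol → inj₁ (Assembly.decomposition G k (Assembly.piece G k sol))) , inj₂ ]′ (Haven.duality G k)

  searchable⇒decomposition : ∀ {k} → Searchable G k k → HasDecompositionOfWidth≤ G k
  searchable⇒decomposition {k} s =
    [ id , (λ haven → contradiction s (RobberWins.not-searchable G k haven)) ]′ (decomposition-or-haven k)

  -- A haven excludes a decomposition, since the decomposition would give the cops a strategy that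
  -- the robber defeats.
  decomposition? : ∀ k → Dec (HasDecompositionOfWidth≤ G k)
  decomposition? k = [ yes , (λ haven → no (RobberWins.not-searchable G k haven ∘ decomposition⇒searchable)) ]′
    (decomposition-or-haven k)

  decomposition-mono : ∀ {j k} → j ≤ k → HasDecompositionOfWidth≤ G j → HasDecompositionOfWidth≤ G k
  decomposition-mono j≤k (D , adhesion , bags) = D ,
    (λ t → case adhesion t of λ (S , eq , le) → S , eq , ≤-trans le j≤k) ,
    (λ t → ≤-trans (bags t) j≤k)

  -- The search descends from `k` and stops at the first failure, since by monotonicity all smaller
  -- widths fail too.
  least-width : ∀ k → HasDecompositionOfWidth≤ G k → ABTreeCutWidth≤ G k
  least-width zero    has = 0 , (has , λ _ _ → z≤n) , z≤n
  least-width (suc k) has = decide (decomposition? k)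
    where
    decide : Dec (HasDecompositionOfWidth≤ G k) → ABTreeCutWidth≤ G (suc k)
    decide (yes has′) = case least-width k has′ of λ (w , isWidth , w≤k) → w , isWidth , ≤-trans w≤k (n≤1+n k)
    decide (no ¬has′) =
      suc k , (has , λ j hasʲ → ≰⇒> (λ j≤k → ¬has′ (decomposition-mono j≤k hasʲ))) , ≤-refl

corollary5p2 : (G : Graph) → 0 < Graph.order G → (k : ℕ) → ABTreeCutWidth≤ G k ⇔ Searchable G k k
corollary5p2 G _ k = mk⇔
  (λ (w , (has , _) , w≤k) → decomposition⇒searchable G (decomposition-mono G w≤k has))
  (λ s → least-width G k (searchable⇒decomposition G s))
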